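{- For all integers $n \geq 1$ and all real $x$, \begin{align*} c_{2n}(x) & = n \sum_{m=1}^n \frac{u(n,m)}{m} \big( (x+n-1)^{2m} - B_{2m} \big), \\ \widehat{c}_{2n}(x) & = n \sum_{m=1}^n \frac{u(n,m)}{m} \big( (x-n)^{2m} - B_{2m} \big), \\ c_{2n+1}(x) & = -(2n+1) \sum_{m=1}^n \frac{u(n,m)}{2m+1} E_{2m+1}(x+n), \\ \widehat{c}_{2n+1}(x) & = (2n+1) \sum_{m=1}^n \frac{u(n,m)}{2m+1} E_{2m+1}(x -n). \end{align*}
   Context: For real $z$ and integer $n\ge 0$, $\binom{z}{n} = \frac{z(z-1)\cdots(z-n+1)}{n!}$. The Cauchy polynomials of the first and second kind are $c_n(x) = n! \int_{0}^{1} \binom{t - x}{n}\, dt$ and $\widehat{c}_n(x) = n! \int_{0}^{1} \binom{x - t}{n}\, dt$, $n \ge 0$. $u(n,m)=t(2n,2m)$ are the (signed) central factorial numbers of the first kind with even indices, i.e. the coefficients in $\prod_{j=0}^{n-1}(z^2-j^2)=\sum_{m=1}^{n} u(n,m) z^{2m}$ for $n \ge 1$. $B_m$ are the Bernoulli numbers, $\frac{t}{e^t-1}=\sum_{m\ge0} B_m \frac{t^m}{m!}$, and $E_m(x)$ are the Euler polynomials, $\frac{2e^{xt}}{e^t+1}=\sum_{m\ge0}E_m(x)\frac{t^m}{m!}$. -}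

module Defs where

open import Level using (_⊔_) renaming (suc to lsuc)
open import Data.Nat.Base as ℕ using (ℕ; zero; suc; NonZero; _∸_; _!)
open import Data.Nat.Properties using (_!≢0)
open import Data.Fin.Base as Fin using (Fin; zero; suc; toℕ; inject₁)
open import Data.Product.Base using (∃; ∃-syntax; _×_; _,_; proj₁; proj₂)
open import Data.Sum.Base using (_⊎_; inj₁; inj₂)
open import Relation.Nullary.Negation using (¬_)
open import Relation.Binary.Core using (Rel)
open import Relation.Binary.Structures using (IsStrictPartialOrder)
open import Algebra.Bundles using (CommutativeRing; Semiring)
open import Algebra.Apartness.Bundles using (HeytingField; HeytingCommutativeRing)
import Algebra.Definitions.RawSemiring as RawSemiringDefs

-- The real numbers, axiomatised as a Cauchy-complete Archimedean ordered
-- field.  The axioms are phrased so that they also hold constructively; with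
-- excluded middle they are the usual ones, which determine ℝ up to a unique
-- isomorphism.  Comparison (x < y → x < z ⊎ z < y) and antisymmetry of _≤_
-- follow from cotransitivity and tightness of _#_.

record RealField c ℓ₁ ℓ₂ : Set (lsuc (c ⊔ ℓ₁ ⊔ ℓ₂)) where
  infix 4 _<_ _≤_
  field
    heytingField : HeytingField c ℓ₁ ℓ₂

  open HeytingField heytingField public hiding (zero)

  commutativeRing : CommutativeRing c ℓ₁
  commutativeRing = HeytingCommutativeRing.commutativeRing heytingCommutativeRing

  open Semiring (CommutativeRing.semiring commutativeRing) public using (rawSemiring)
  open RawSemiringDefs rawSemiring public
    using (_^_; sum) renaming (_×_ to _·_)

  fromℕ : ℕ → Carrier
  fromℕ n = n · 1#

  field
    _<_                    : Rel Carrier ℓ₂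
    <-isStrictPartialOrder : IsStrictPartialOrder _≈_ _<_
    #⇒<⊎>                  : ∀ {x y} → x # y → x < y ⊎ y < x
    <⇒#                    : ∀ {x y} → x < y → x # y
    0<1                    : 0# < 1#
    +-monoˡ-<              : ∀ z {x y} → x < y → x + z < y + z
    *-pos                  : ∀ {x y} → 0# < x → 0# < y → 0# < x * y
    archimedean            : ∀ x → ∃[ n ] x < fromℕ n

  _≤_ : Rel Carrier ℓ₂
  x ≤ y = ¬ (y < x)

  -- ∣ x − y ∣ ≤ ε
  Within : Carrier → Carrier → Carrier → Set ℓ₂
  Within ε x y = (x - y ≤ ε) × (y - x ≤ ε)

  IsCauchySequence : (ℕ → Carrier) → Set (c ⊔ ℓ₂)
  IsCauchySequence s = ∀ ε → 0# < ε →
    ∃[ N ] (∀ m n → N ℕ.≤ m → N ℕ.≤ n → Within ε (s m) (s n))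

  ConvergesTo : (ℕ → Carrier) → Carrier → Set (c ⊔ ℓ₂)
  ConvergesTo s l = ∀ ε → 0# < ε →
    ∃[ N ] (∀ n → N ℕ.≤ n → Within ε (s n) l)

  field
    complete : ∀ s → IsCauchySequence s → ∃[ l ] ConvergesTo s l

module Reciprocals {c ℓ₁ ℓ₂} (R : RealField c ℓ₁ ℓ₂) where

  open RealField R
  open IsStrictPartialOrder <-isStrictPartialOrder public using ()
    renaming (trans to <-trans; <-respʳ-≈ to <-respʳ; <-respˡ-≈ to <-respˡ)

  infixl 7 _/ℕ_

  x-0≈x : ∀ x → x - 0# ≈ x
  x-0≈x x = trans (sym (+-congʳ (+-identityʳ x)))
                  (trans (+-assoc x 0# (- 0#))
                         (trans (+-congˡ (-‿inverseʳ 0#)) (+-identityʳ x)))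

  inverse : ∀ {x} → x # 0# → Carrier
  inverse x#0 = proj₁ (#⇒invertible x#0)

  inverse-* : ∀ {x} (x#0 : x # 0#) → inverse x#0 * x ≈ 1#
  inverse-* {x} x#0 =
    trans (*-congˡ (sym (x-0≈x x))) (proj₁ (proj₂ (#⇒invertible x#0)))

  left-inverse⇒# : ∀ {x} y → y * x ≈ 1# → x # 0#
  left-inverse⇒# {x} y yx≈1 = invertible⇒# (y , yx-0≈1 , trans (*-comm _ _) yx-0≈1)
    where
    yx-0≈1 : y * (x - 0#) ≈ 1#
    yx-0≈1 = trans (*-congˡ (x-0≈x x)) yx≈1

  +-pos : ∀ {x y} → 0# < x → 0# < y → 0# < x + y
  +-pos {x} {y} 0<x 0<y =
    <-trans 0<y (<-respˡ (+-identityˡ y) (+-monoˡ-< y 0<x))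

  fromℕ-pos : ∀ n .{{_ : NonZero n}} → 0# < fromℕ n
  fromℕ-pos (suc zero)    = <-respʳ (sym (+-identityʳ 1#)) 0<1
  fromℕ-pos (suc (suc n)) = +-pos 0<1 (fromℕ-pos (suc n))

  fromℕ#0 : ∀ n .{{_ : NonZero n}} → fromℕ n # 0#
  fromℕ#0 n = #-sym (<⇒# (fromℕ-pos n))

  _/ℕ_ : Carrier → (n : ℕ) .{{_ : NonZero n}} → Carrier
  x /ℕ n = x * inverse (fromℕ#0 n)

  /ℕ-1 : ∀ x → x /ℕ 1 ≈ x
  /ℕ-1 x = trans (*-congˡ inverse≈1) (*-identityʳ x)
    where
    inverse≈1 : inverse (fromℕ#0 1) ≈ 1#
    inverse≈1 = trans (sym (*-identityʳ _))
                      (trans (*-congˡ (sym (+-identityʳ 1#))) (inverse-* (fromℕ#0 1)))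

-- A formal power series (or polynomial) is its sequence of coefficients.

module PowerSeries {c ℓ₁ ℓ₂} (R : RealField c ℓ₁ ℓ₂) where

  open RealField R
  open Reciprocals R

  infixl 7 _*ˢ_
  infixl 6 _+ˢ_ _-ˢ_

  Series : Set c
  Series = ℕ → Carrier

  const : Carrier → Series
  const a zero    = a
  const a (suc _) = 0#

  X : Series
  X 1 = 1#
  X _ = 0#

  _+ˢ_ _-ˢ_ _*ˢ_ : Series → Series → Series
  (f +ˢ g) n = f n + g n
  (f -ˢ g) n = f n - g n
  (f *ˢ g) n = sum {suc n} λ k → f (toℕ k) * g (n ∸ toℕ k)

  -- For f with zero constant term, this is f / X.
  tail : Series → Series
  tail f n = f (suc n)

  -- Long division: with q₀ = f₀ / g₀, the remaining coefficients of f / g are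
  -- those of (tail f − q₀ tail g) / g.
  divide : (f g : Series) → g 0 # 0# → Series
  divide f g g₀#0 zero    = f 0 * inverse g₀#0
  divide f g g₀#0 (suc n) =
    divide (tail f -ˢ const (f 0 * inverse g₀#0) *ˢ tail g) g g₀#0 n

  -- exp a is e^{aX}.
  exp : Carrier → Series
  exp a k = _/ℕ_ (a ^ k) (k !) {{k !≢0}}

module CauchyPolynomials {c ℓ₁ ℓ₂} (R : RealField c ℓ₁ ℓ₂) where

  open RealField R
  open Reciprocals R public
  open PowerSeries R public

  infix 4 c[_,_]≈_ ĉ[_,_]≈_

  -- Σ[1≤m≤ n ] f is f 1 + … + f n; the summand is given m with the
  -- evidence that m is nonzero, so that it may divide by m.
  Σ[1≤m≤_] : ℕ → ((m : ℕ) .{{_ : NonZero m}} → Carrier) → Carrier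
  Σ[1≤m≤ n ] f = sum {n} λ i → f (suc (toℕ i))

  record TaggedPartition (a b : Carrier) : Set (c ⊔ ℓ₁ ⊔ ℓ₂) where
    field
      size      : ℕ
      point     : Fin (suc size) → Carrier
      tag       : Fin size → Carrier
      first     : point zero ≈ a
      last      : point (Fin.fromℕ size) ≈ b
      point≤tag : ∀ i → point (inject₁ i) ≤ tag i
      tag≤point : ∀ i → tag i ≤ point (suc i)

    width : Fin size → Carrier
    width i = point (suc i) - point (inject₁ i)

    riemannSum : (Carrier → Carrier) → Carrier
    riemannSum f = sum λ i → f (tag i) * width i

  IsIntegral : (Carrier → Carrier) → (a b I : Carrier) → Set (c ⊔ ℓ₁ ⊔ ℓ₂)
  IsIntegral f a b I = ∀ ε → 0# < ε → ∃[ δ ] (0# < δ ×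
    ((P : TaggedPartition a b) → let open TaggedPartition P in
      (∀ i → width i ≤ δ) → Within ε (riemannSum f) I))

  fallingFactorial : Carrier → ℕ → Carrier
  fallingFactorial z zero    = 1#
  fallingFactorial z (suc n) = fallingFactorial z n * (z - fromℕ n)

  binomial : Carrier → ℕ → Carrier
  binomial z n = _/ℕ_ (fallingFactorial z n) (n !) {{n !≢0}}

  -- Integration is a relation here, so the Cauchy polynomials are too:
  -- the first says that binomial (t − x) n is Riemann integrable over
  -- t ∈ [0,1] and that n ! times the integral, i.e. c_n(x), is y.
  c[_,_]≈_ : ℕ → Carrier → Carrier → Set (c ⊔ ℓ₁ ⊔ ℓ₂)
  c[ n , x ]≈ y =
    ∃[ I ] (IsIntegral (λ t → binomial (t - x) n) 0# 1# I × y ≈ fromℕ (n !) * I)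

  ĉ[_,_]≈_ : ℕ → Carrier → Carrier → Set (c ⊔ ℓ₁ ⊔ ℓ₂)
  ĉ[ n , x ]≈ y =
    ∃[ I ] (IsIntegral (λ t → binomial (x - t) n) 0# 1# I × y ≈ fromℕ (n !) * I)

  -- The polynomial ∏_{j<n} (X² − j²).
  centralFactorial : ℕ → Series
  centralFactorial zero    = const 1#
  centralFactorial (suc n) = (X *ˢ X -ˢ const (fromℕ n ^ 2)) *ˢ centralFactorial n

  u : ℕ → ℕ → Carrier
  u n m = centralFactorial n (2 ℕ.* m)

  [exp-1]/X#0 : tail (exp 1# -ˢ const 1#) 0 # 0#
  [exp-1]/X#0 = left-inverse⇒# 1# (trans (*-identityˡ _) (trans (x-0≈x _)
    (trans (/ℕ-1 _) (*-identityˡ 1#))))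

  [exp+1]#0 : (exp 1# +ˢ const 1#) 0 # 0#
  [exp+1]#0 = #-sym (<⇒# (+-pos (<-respʳ (sym (/ℕ-1 1#)) 0<1) 0<1))

  -- X / (e^X − 1) = Σ B_m X^m / m!, with numerator and denominator both
  -- divided by X so that the denominator becomes invertible.
  B : ℕ → Carrier
  B m = fromℕ (m !) * divide (tail X) (tail (exp 1# -ˢ const 1#)) [exp-1]/X#0 m

  -- 2 e^{xX} / (e^X + 1) = Σ E_m(x) X^m / m!
  E : ℕ → Carrier → Carrier
  E m x = fromℕ (m !) * divide (const (fromℕ 2) *ˢ exp x) (exp 1# +ˢ const 1#) [exp+1]#0 m

{-# OPTIONS --safe #-}
module Submission where

open import Defs
open import Algebra.Bundles using (CommutativeRing)
open import Algebra.Solver.Ring.AlmostCommutativeRing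
  using (fromCommutativeRing; _-Raw-AlmostCommutative⟶_)
open import Algebra.Structures using (IsCommutativeRing)
open import Data.Empty using (⊥-elim)
open import Data.Fin.Base as Fin using (Fin; zero; suc; toℕ; inject₁)
open import Data.Integer.Base as ℤ using (ℤ; +_; -[1+_]; _⊖_)
open import Data.Maybe.Base using (map)
open import Data.Nat.Base as ℕ using (ℕ; zero; suc; NonZero; _!)
open import Data.Product.Base using (∃-syntax; _×_; _,_)
open import Data.Sum.Base using (inj₁; inj₂)
open import Function.Base using (_∘_)
open import Level using (_⊔_)
open import Relation.Binary.Consequences using (dec⇒weaklyDec)
open import Relation.Binary.PropositionalEquality.Core as ≡ using (_≡_)
open import Relation.Binary.Structures using (IsStrictPartialOrder)
import Algebra.Properties.AbelianGroup as AbelianGroupProperties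
import Algebra.Properties.CommutativeMonoid.Sum as MonoidSum
import Algebra.Properties.Ring as RingProperties
import Algebra.Properties.Semiring.Exp as SemiringExp
import Algebra.Properties.Semiring.Mult as SemiringMult
import Algebra.Properties.Semiring.Mult.TCOptimised as Mult
import Algebra.Properties.Semiring.Sum as SemiringSum
import Algebra.Solver.Ring as Ring-Solver
import Data.Integer.Properties as ℤ
import Data.Nat.Properties as ℕ
import Relation.Binary.Reasoning.Setoid as SetoidReasoning

-- Treat a series f as the operand of polynomials in D = d/dX evaluated at
-- X = 0: since p(D) e^{zX} at 0 is p(z), the falling factorial of z is
-- D (D − 1) ⋯ applied to e^{zX}, and integrating over t only replaces e^{−tX}
-- by ρ = (1 − e^{−X}) / X.  Hence ĉ_N(x) = D (D − 1) ⋯ (D − N + 1) (e^{xX} ρ)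
-- at 0, which after conjugation by e^{nX} becomes
-- (D + n) ⋯ (D + n − N + 1) (e^{yX} ρ) with y = x − n.
--
-- N = 2n: subtract b = Σ B_m X^m / m! from e^{yX}.  Since b ρ = e^{−X} is
-- annihilated, and e^{yX} − b = X h, Xρ = 1 − e^{−X} turns the difference of the
-- operator and its shift by 1 into 2n ∏_{|j|<n} (D − j) h.
-- N = 2n + 1: write e^{yX} = (e^X + 1) g, so (e^X + 1) ρ = (e^X − e^{−X}) / X is
-- even.  The odd operator annihilates g(0) times it; on the rest, X h, the
-- difference of two shifts is 2 (2n + 1) D ∏_{|j|<n} (D − j) h.
-- The formulas for c follow from c_N(x) = ĉ_N(1 − x).

-- The denominators come from counting factors D. The product ∏_{|j|<n} (D - j) = D ∏_{0<j<n} (D² -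
-- j²) contains D once, whereas the u(n,m) are the coefficients of D² ∏_{0<j<n} (D² - j²). For N =
-- 2n the missing D is gained by writing h as the derivative of its formal antiderivative, which
-- divides the coefficient of X^{2m} by 2m. For N = 2n + 1 the difference of shifts already brings
-- the second D, and (2m)! times the coefficient of X^{2m+1} in 2g is E_{2m+1}(y) / (2m + 1). Series
-- in X also keep analysis to a minimum: each coefficient of the integrand is a polynomial in t, so
-- linearity and the integrals of the powers t^k suffice. These are certified constructively, by an
-- antiderivative with an explicit quadratic error.

-- A ring solver with integer coefficients.

-- Equality of coefficients is decidable in ℤ but not in R, so only integer
-- coefficients let the solver cancel.
module ℤ-RingSolver {c ℓ} (R : CommutativeRing c ℓ) where

  open CommutativeRing R
  open RingProperties ring using (-‿distribˡ-*; -‿distribʳ-*)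
  open AbelianGroupProperties +-abelianGroup
    using (⁻¹-∙-comm; ε⁻¹≈ε; ⁻¹-involutive)
  open Mult semiring using ()
    renaming (_×_ to _·_; 1+× to 1+·; ×-homo-+ to ·-homo-+; ×1-homo-* to ·1-homo-*)
  open SetoidReasoning setoid

  fromℤ : ℤ → Carrier
  fromℤ (+ n)    = n · 1#
  fromℤ -[1+ n ] = - (suc n · 1#)

  fromℤ-neg : ∀ i → fromℤ (ℤ.- i) ≈ - fromℤ i
  fromℤ-neg (+ zero)  = sym ε⁻¹≈ε
  fromℤ-neg (+ suc n) = refl
  fromℤ-neg -[1+ n ]  = sym (⁻¹-involutive _)

  fromℤ-⊖ : ∀ m n → fromℤ (m ⊖ n) ≈ m · 1# - n · 1#
  fromℤ-⊖ m zero = sym (trans (+-congˡ ε⁻¹≈ε) (+-identityʳ _))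
  fromℤ-⊖ zero (suc n) = sym (+-identityˡ _)
  fromℤ-⊖ (suc m) (suc n) = begin
    fromℤ (suc m ⊖ suc n)                     ≡⟨ ≡.cong fromℤ (ℤ.[1+m]⊖[1+n]≡m⊖n m n) ⟩
    fromℤ (m ⊖ n)                             ≈⟨ fromℤ-⊖ m n ⟩
    m · 1# - n · 1#                           ≈⟨ +-congʳ (+-identityʳ _) ⟨
    m · 1# + 0# - n · 1#                      ≈⟨ +-congʳ (+-congˡ (-‿inverseʳ 1#)) ⟨
    m · 1# + (1# - 1#) - n · 1#               ≈⟨ +-congʳ (+-assoc _ _ _) ⟨
    m · 1# + 1# - 1# - n · 1#                 ≈⟨ +-assoc _ _ _ ⟩
    m · 1# + 1# + (- 1# - n · 1#)             ≈⟨ +-cong (+-comm _ _) (⁻¹-∙-comm _ _) ⟩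
    1# + m · 1# - (1# + n · 1#)               ≈⟨ +-cong (1+· m 1#) (-‿cong (1+· n 1#)) ⟨
    suc m · 1# - suc n · 1#                   ∎

  fromℤ-+ : ∀ i j → fromℤ (i ℤ.+ j) ≈ fromℤ i + fromℤ j
  fromℤ-+ (+ m)    (+ n)    = ·-homo-+ 1# m n
  fromℤ-+ (+ m)    -[1+ n ] = fromℤ-⊖ m (suc n)
  fromℤ-+ -[1+ m ] (+ n)    = trans (fromℤ-⊖ n (suc m)) (+-comm _ _)
  fromℤ-+ -[1+ m ] -[1+ n ] = begin
    - (suc (suc (m ℕ.+ n)) · 1#)       ≈⟨ -‿cong (1+· (suc (m ℕ.+ n)) 1#) ⟩
    - (1# + suc (m ℕ.+ n) · 1#)        ≈⟨ -‿cong (+-congˡ (·-homo-+ 1# (suc m) n)) ⟩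
    - (1# + (suc m · 1# + n · 1#))     ≈⟨ -‿cong (+-assoc _ _ _) ⟨
    - (1# + suc m · 1# + n · 1#)       ≈⟨ -‿cong (+-congʳ (+-comm _ _)) ⟩
    - (suc m · 1# + 1# + n · 1#)       ≈⟨ -‿cong (+-assoc _ _ _) ⟩
    - (suc m · 1# + (1# + n · 1#))     ≈⟨ -‿cong (+-congˡ (1+· n 1#)) ⟨
    - (suc m · 1# + suc n · 1#)        ≈⟨ ⁻¹-∙-comm _ _ ⟨
    - (suc m · 1#) - suc n · 1#        ∎

  fromℤ-+* : ∀ m j → fromℤ (+ m ℤ.* j) ≈ m · 1# * fromℤ j
  fromℤ-+* m (+ n) = begin
    fromℤ (+ m ℤ.* + n)      ≡⟨ ≡.cong fromℤ (ℤ.pos-* m n) ⟨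
    (m ℕ.* n) · 1#           ≈⟨ ·1-homo-* m n ⟩
    m · 1# * (n · 1#)        ∎
  fromℤ-+* m -[1+ n ] = begin
    fromℤ (+ m ℤ.* -[1+ n ])          ≡⟨ ≡.cong fromℤ (ℤ.neg-distribʳ-* (+ m) (+ suc n)) ⟨
    fromℤ (ℤ.- (+ m ℤ.* + suc n))     ≈⟨ fromℤ-neg (+ m ℤ.* + suc n) ⟩
    - fromℤ (+ m ℤ.* + suc n)         ≈⟨ -‿cong (fromℤ-+* m (+ suc n)) ⟩
    - (m · 1# * (suc n · 1#))         ≈⟨ -‿distribʳ-* _ _ ⟩
    m · 1# * - (suc n · 1#)           ∎

  fromℤ-* : ∀ i j → fromℤ (i ℤ.* j) ≈ fromℤ i * fromℤ j
  fromℤ-* (+ m)    j = fromℤ-+* m j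
  fromℤ-* -[1+ m ] j = begin
    fromℤ (-[1+ m ] ℤ.* j)           ≡⟨ ≡.cong fromℤ (ℤ.neg-distribˡ-* (+ suc m) j) ⟨
    fromℤ (ℤ.- (+ suc m ℤ.* j))      ≈⟨ fromℤ-neg (+ suc m ℤ.* j) ⟩
    - fromℤ (+ suc m ℤ.* j)          ≈⟨ -‿cong (fromℤ-+* (suc m) j) ⟩
    - (suc m · 1# * fromℤ j)         ≈⟨ -‿distribˡ-* _ _ ⟩
    - (suc m · 1#) * fromℤ j         ∎

  fromℤ-homomorphism : ℤ.+-*-rawRing -Raw-AlmostCommutative⟶ fromCommutativeRing R
  fromℤ-homomorphism = record
    { ⟦_⟧    = fromℤ
    ; +-homo = fromℤ-+
    ; *-homo = fromℤ-*
    ; -‿homo = fromℤ-neg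
    ; 0-homo = refl
    ; 1-homo = refl
    }

  open Ring-Solver ℤ.+-*-rawRing (fromCommutativeRing R) fromℤ-homomorphism
    (λ i j → map (λ i≡j → reflexive (≡.cong fromℤ i≡j)) (dec⇒weaklyDec ℤ._≟_ i j)) public
    using (solve; _:=_; _:+_; _:*_; _:-_; :-_; con; Polynomial)

  :0 :1 : ∀ {n} → Polynomial n
  :0 = con (+ 0)
  :1 = con (+ 1)

-- Constructive order and approximation on the reals.

module OrderedField {c ℓ₁ ℓ₂} (ℝ : RealField c ℓ₁ ℓ₂) where

  open RealField ℝ
  open CauchyPolynomials ℝ
  open CommutativeRing commutativeRing using (semiring)
  open ℤ-RingSolver commutativeRing public
    using (solve; _:=_; _:+_; _:*_; _:-_; :-_; :0; :1)
  open SetoidReasoning setoid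
  open SemiringMult semiring using () renaming (×-homo-+ to ·-homo-+; ×1-homo-* to ·1-homo-*)
  open SemiringExp semiring using (^-congˡ)
  private module < = IsStrictPartialOrder <-isStrictPartialOrder

  fromℕ-+ : ∀ m n → fromℕ (m ℕ.+ n) ≈ fromℕ m + fromℕ n
  fromℕ-+ = ·-homo-+ 1#

  fromℕ-* : ∀ m n → fromℕ (m ℕ.* n) ≈ fromℕ m * fromℕ n
  fromℕ-* = ·1-homo-*

  <⇒≤ : ∀ {x y} → x < y → x ≤ y
  <⇒≤ x<y y<x = <.irrefl refl (<-trans x<y y<x)

  ≤-reflexive : ∀ {x y} → x ≈ y → x ≤ y
  ≤-reflexive x≈y y<x = <.irrefl (sym x≈y) y<x

  ≤-respˡ : ∀ {x y z} → x ≈ y → x ≤ z → y ≤ z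
  ≤-respˡ x≈y x≤z z<y = x≤z (<-respʳ (sym x≈y) z<y)

  ≤-respʳ : ∀ {x y z} → x ≈ y → z ≤ x → z ≤ y
  ≤-respʳ x≈y z≤x y<z = z≤x (<-respˡ (sym x≈y) y<z)

  -- Since `_≤_` is a negation, there is nothing to compose directly. A supposed `z < x` is instead
  -- compared with `y` by cotransitivity of `_#_`, and each outcome contradicts one hypothesis.
  ≤-trans : ∀ {x y z} → x ≤ y → y ≤ z → x ≤ z
  ≤-trans {y = y} x≤y y≤z z<x with #-cotrans (<⇒# z<x) y
  ... | inj₁ z#y with #⇒<⊎> z#y
  ...   | inj₁ z<y = y≤z z<y
  ...   | inj₂ y<z = x≤y (<-trans y<z z<x)
  ≤-trans {y = y} x≤y y≤z z<x | inj₂ y#x with #⇒<⊎> y#x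
  ...   | inj₁ y<x = x≤y y<x
  ...   | inj₂ x<y = y≤z (<-trans z<x x<y)

  ≤⇒0≤ : ∀ {x y} → x ≤ y → 0# ≤ y - x
  ≤⇒0≤ {x} {y} x≤y y-x<0 = x≤y
    (<-respˡ (solve 2 (λ x y → (y :- x) :+ x := y) refl x y)
      (<-respʳ (+-identityˡ x) (+-monoˡ-< x y-x<0)))

  -- The nonnegative quantity `z` is kept apart from `y - x`, so that an inequality is proved by a
  -- certificate: a visibly nonnegative expression, and a ring identity equating it with the
  -- difference.
  0≤⇒≤ : ∀ {x y z} → 0# ≤ z → z ≈ y - x → x ≤ y
  0≤⇒≤ {x} {y} {z} 0≤z z≈y-x y<x = 0≤z
    (<-respˡ (sym z≈y-x) (<-respʳ (-‿inverseʳ x) (+-monoˡ-< (- x) y<x)))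

  0≤+ : ∀ {x y} → 0# ≤ x → 0# ≤ y → 0# ≤ x + y
  0≤+ {x} {y} 0≤x 0≤y = ≤-trans 0≤x
    (0≤⇒≤ 0≤y (solve 2 (λ x y → y := x :+ y :- x) refl x y))

  *#0ˡ : ∀ {x y} → x * y # 0# → x # 0#
  *#0ˡ {x} {y} xy#0 = left-inverse⇒# (inverse xy#0 * y)
    (trans (trans (*-assoc _ _ _) (*-congˡ (*-comm y x))) (inverse-* xy#0))

  0≤∧#0⇒0< : ∀ {x} → 0# ≤ x → x # 0# → 0# < x
  0≤∧#0⇒0< 0≤x x#0 with #⇒<⊎> x#0
  ... | inj₁ x<0 = ⊥-elim (0≤x x<0)
  ... | inj₂ 0<x = 0<x

  -- A nonnegative number cannot be split into zero or positive. But the assumption `x * y < 0#` to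
  -- be refuted makes the product invertible, hence both factors apart from zero, hence both
  -- positive.
  0≤* : ∀ {x y} → 0# ≤ x → 0# ≤ y → 0# ≤ x * y
  0≤* {x} {y} 0≤x 0≤y xy<0 = <⇒≤ (*-pos 0<x 0<y) xy<0
    where
    0<x : 0# < x
    0<x = 0≤∧#0⇒0< 0≤x (*#0ˡ (<⇒# xy<0))
    0<y : 0# < y
    0<y = 0≤∧#0⇒0< 0≤y (*#0ˡ (<⇒# (<-respˡ (*-comm x y) xy<0)))

  0≤1 : 0# ≤ 1#
  0≤1 = <⇒≤ 0<1

  0≤fromℕ : ∀ n → 0# ≤ fromℕ n
  0≤fromℕ zero    = ≤-reflexive refl
  0≤fromℕ (suc n) = 0≤+ 0≤1 (0≤fromℕ n)

  inverse-pos : ∀ {x} (x#0 : x # 0#) → 0# < x → 0# < inverse x#0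
  inverse-pos {x} x#0 0<x = 0≤∧#0⇒0< 0≤i (*#0ˡ (#-sym (<⇒# 0<i*x)))
    where
    0<i*x : 0# < inverse x#0 * x
    0<i*x = <-respʳ (sym (inverse-* x#0)) 0<1

    0≤i : 0# ≤ inverse x#0
    0≤i i<0 = <⇒≤ 0<i*x (<-respˡ (+-identityˡ _) (<-respʳ
      (solve 2 (λ i x → (:- i) :* x :+ i :* x := :0) refl (inverse x#0) x)
      (+-monoˡ-< (inverse x#0 * x) (*-pos 0<-i 0<x))))
      where
      0<-i : 0# < - inverse x#0
      0<-i = <-respˡ (-‿inverseʳ _) (<-respʳ (+-identityˡ _) (+-monoˡ-< (- inverse x#0) i<0))

  /ℕ-pos : ∀ {x} n .{{_ : NonZero n}} → 0# < x → 0# < x /ℕ n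
  /ℕ-pos n 0<x = *-pos 0<x (inverse-pos (fromℕ#0 n) (fromℕ-pos n))

  *-/ℕ : ∀ n .{{_ : NonZero n}} x → fromℕ n * (x /ℕ n) ≈ x
  *-/ℕ n x = begin
    fromℕ n * (x * inverse (fromℕ#0 n))  ≈⟨ solve 3 (λ n x i → n :* (x :* i) := x :* (i :* n)) refl _ _ _ ⟩
    x * (inverse (fromℕ#0 n) * fromℕ n)  ≈⟨ *-congˡ (inverse-* (fromℕ#0 n)) ⟩
    x * 1#                               ≈⟨ *-identityʳ x ⟩
    x                                    ∎

  *-cancel-fromℕ : ∀ n .{{_ : NonZero n}} {x y} → fromℕ n * x ≈ fromℕ n * y → x ≈ y
  *-cancel-fromℕ n {x} {y} nx≈ny = begin
    x                                    ≈⟨ lemma x ⟨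
    inverse (fromℕ#0 n) * (fromℕ n * x)  ≈⟨ *-congˡ nx≈ny ⟩
    inverse (fromℕ#0 n) * (fromℕ n * y)  ≈⟨ lemma y ⟩
    y                                    ∎
    where
    lemma : ∀ z → inverse (fromℕ#0 n) * (fromℕ n * z) ≈ z
    lemma z = trans (sym (*-assoc _ _ _)) (trans (*-congʳ (inverse-* (fromℕ#0 n))) (*-identityˡ z))

  Within-cong : ∀ {ε ε′ x x′ y y′} → ε ≈ ε′ → x ≈ x′ → y ≈ y′ → Within ε x y → Within ε′ x′ y′
  Within-cong ε≈ x≈ y≈ (p , q) =
    ≤-respˡ (+-cong x≈ (-‿cong y≈)) (≤-respʳ ε≈ p) ,
    ≤-respˡ (+-cong y≈ (-‿cong x≈)) (≤-respʳ ε≈ q)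

  Within-≤ : ∀ {ε ε′ x y} → ε ≤ ε′ → Within ε x y → Within ε′ x y
  Within-≤ ε≤ε′ (p , q) = ≤-trans p ε≤ε′ , ≤-trans q ε≤ε′

  Within-+ : ∀ {ε ε′ x x′ y y′} → Within ε x y → Within ε′ x′ y′ → Within (ε + ε′) (x + x′) (y + y′)
  Within-+ {ε} {ε′} {x} {x′} {y} {y′} (p , q) (p′ , q′) =
    0≤⇒≤ (0≤+ (≤⇒0≤ p) (≤⇒0≤ p′)) (rearrange ε ε′ x x′ y y′) ,
    0≤⇒≤ (0≤+ (≤⇒0≤ q) (≤⇒0≤ q′)) (rearrange ε ε′ y y′ x x′)
    where
    rearrange : ∀ ε ε′ x x′ y y′ →
      (ε - (x - y)) + (ε′ - (x′ - y′)) ≈ (ε + ε′) - ((x + x′) - (y + y′))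
    rearrange = solve 6 (λ ε ε′ x x′ y y′ →
      (ε :- (x :- y)) :+ (ε′ :- (x′ :- y′)) := (ε :+ ε′) :- ((x :+ x′) :- (y :+ y′))) refl

  halve : ∀ {x} → 0# ≤ x + x → 0# ≤ x
  halve 0≤2x x<0 = 0≤2x (<-trans (<-respʳ (+-identityˡ _) (+-monoˡ-< _ x<0)) x<0)

  -- |c d| ≤ n e, from the nonnegative products (n ∓ c)(e ± d).
  bounded-* : ∀ {n c d e} → c ≤ n → - c ≤ n → d ≤ e → - d ≤ e → c * d ≤ n * e
  bounded-* {n} {c} {d} {e} c≤n -c≤n d≤e -d≤e = 0≤⇒≤
    (halve (≤-respʳ
      (solve 4 (λ n c d e →
        (n :- c) :* (e :- :- d) :+ (n :- :- c) :* (e :- d)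
          := (n :* e :- c :* d) :+ (n :* e :- c :* d)) refl n c d e)
      (0≤+ (0≤* (≤⇒0≤ c≤n) (≤⇒0≤ -d≤e)) (0≤* (≤⇒0≤ -c≤n) (≤⇒0≤ d≤e)))))
    refl

  Within-* : ∀ {n c ε x y} → c ≤ n → - c ≤ n → Within ε x y → Within (n * ε) (c * x) (c * y)
  Within-* {n} {c} {ε} {x} {y} c≤n -c≤n (p , q) =
    ≤-respˡ (expand x y) (bounded-* c≤n -c≤n p (≤-respˡ (flip x y) q)) ,
    ≤-respˡ (expand y x) (bounded-* c≤n -c≤n q (≤-respˡ (flip y x) p))
    where
    expand : ∀ x y → c * (x - y) ≈ c * x - c * y
    expand = solve 3 (λ c x y → c :* (x :- y) := c :* x :- c :* y) refl c
    flip : ∀ x y → y - x ≈ - (x - y)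
    flip = solve 2 (λ x y → y :- x := :- (x :- y)) refl

  bound : ∀ x → ∃[ n ] (x ≤ fromℕ n × - x ≤ fromℕ n)
  bound x with archimedean x | archimedean (- x)
  ... | m , x<m | n , -x<n = m ℕ.+ n ,
    ≤-respʳ (sym (fromℕ-+ m n)) (≤-trans (<⇒≤ x<m)
      (0≤⇒≤ (0≤fromℕ n) (solve 2 (λ m n → n := m :+ n :- m) refl _ _))) ,
    ≤-respʳ (sym (fromℕ-+ m n)) (≤-trans (<⇒≤ -x<n)
      (0≤⇒≤ (0≤fromℕ m) (solve 2 (λ m n → m := m :+ n :- n) refl _ _)))

  -- Integrals certified by antiderivatives.

  -- In a partition of mesh δ the quadratic errors add up to at most M δ.
  record Integral (f : Carrier → Carrier) (I : Carrier) : Set (c ⊔ ℓ₁ ⊔ ℓ₂) where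
    field
      F      : Carrier → Carrier
      F-cong : ∀ {x y} → x ≈ y → F x ≈ F y
      M      : ℕ
      approx : ∀ {a t b} → 0# ≤ a → a ≤ t → t ≤ b → b ≤ 1# →
               Within (fromℕ M * ((b - a) * (b - a))) (f t * (b - a)) (F b - F a)
      total  : F 1# - F 0# ≈ I

  open Integral

  Integral-cong : ∀ {f g I J} → (∀ t → f t ≈ g t) → I ≈ J → Integral f I → Integral g J
  Integral-cong f≈g I≈J p = record
    { F      = F p
    ; F-cong = F-cong p
    ; M      = M p
    ; approx = λ 0≤a a≤t t≤b b≤1 →
        Within-cong refl (*-congʳ (f≈g _)) refl (approx p 0≤a a≤t t≤b b≤1)
    ; total  = trans (total p) I≈J
    }

  Integral-0 : Integral (λ _ → 0#) 0#
  Integral-0 = record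
    { F      = λ _ → 0#
    ; F-cong = λ _ → refl
    ; M      = 0
    ; approx = λ {a} {t} {b} _ _ _ _ →
        ≤-reflexive (solve 1 (λ d → :0 :* d :- (:0 :- :0) := :0 :* (d :* d)) refl (b - a)) ,
        ≤-reflexive (solve 1 (λ d → (:0 :- :0) :- :0 :* d := :0 :* (d :* d)) refl (b - a))
    ; total  = -‿inverseʳ 0#
    }

  Integral-+ : ∀ {f g I J} → Integral f I → Integral g J → Integral (λ t → f t + g t) (I + J)
  Integral-+ {f} {g} p q = record
    { F      = λ t → F p t + F q t
    ; F-cong = λ x≈y → +-cong (F-cong p x≈y) (F-cong q x≈y)
    ; M      = M p ℕ.+ M q
    ; approx = λ 0≤a a≤t t≤b b≤1 → Within-cong
        (trans (sym (distribʳ _ _ _)) (*-congʳ (sym (fromℕ-+ (M p) (M q)))))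
        (sym (distribʳ _ _ _))
        (interchange _ _ _ _)
        (Within-+ (approx p 0≤a a≤t t≤b b≤1) (approx q 0≤a a≤t t≤b b≤1))
    ; total  = trans (sym (interchange _ _ _ _)) (+-cong (total p) (total q))
    }
    where
    interchange : ∀ a b c d → (a - b) + (c - d) ≈ (a + c) - (b + d)
    interchange = solve 4 (λ a b c d → (a :- b) :+ (c :- d) := (a :+ c) :- (b :+ d)) refl

  Integral-* : ∀ {f I} a → Integral f I → Integral (λ t → a * f t) (a * I)
  Integral-* {f} x p with bound x
  ... | n , x≤n , -x≤n = record
    { F      = λ t → x * F p t
    ; F-cong = λ y≈z → *-congˡ (F-cong p y≈z)
    ; M      = n ℕ.* M p
    ; approx = λ 0≤a a≤t t≤b b≤1 → Within-cong
        (trans (sym (*-assoc _ _ _)) (*-congʳ (sym (fromℕ-* n (M p)))))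
        (sym (*-assoc _ _ _))
        (factor _ _)
        (Within-* x≤n -x≤n (approx p 0≤a a≤t t≤b b≤1))
    ; total  = trans (sym (factor _ _)) (*-congˡ (total p))
    }
    where
    factor : ∀ a b → x * (a - b) ≈ x * a - x * b
    factor = solve 3 (λ x a b → x :* (a :- b) := x :* a :- x :* b) refl x

  Integral-sum : ∀ {n} {f : Fin n → Carrier → Carrier} {I : Fin n → Carrier} →
    (∀ i → Integral (f i) (I i)) → Integral (λ t → sum λ i → f i t) (sum I)
  Integral-sum {zero}  p = Integral-0
  Integral-sum {suc n} p = Integral-+ (p zero) (Integral-sum (p ∘ suc))

  0≤^ : ∀ {x} k → 0# ≤ x → 0# ≤ x ^ k
  0≤^ zero    0≤x = 0≤1
  0≤^ (suc k) 0≤x = 0≤* 0≤x (0≤^ k 0≤x)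

  ^-mono-≤ : ∀ {x y} k → 0# ≤ x → x ≤ y → x ^ k ≤ y ^ k
  ^-mono-≤ zero 0≤x x≤y = ≤-reflexive refl
  ^-mono-≤ {x} {y} (suc k) 0≤x x≤y = 0≤⇒≤
    (0≤+ (0≤* (≤⇒0≤ x≤y) (0≤^ k (≤-trans 0≤x x≤y))) (0≤* 0≤x (≤⇒0≤ (^-mono-≤ k 0≤x x≤y))))
    (solve 4 (λ x y p q → (y :- x) :* q :+ x :* (q :- p) := y :* q :- x :* p) refl x y (x ^ k) (y ^ k))

  ^-≤1 : ∀ {x} k → 0# ≤ x → x ≤ 1# → x ^ k ≤ 1#
  ^-≤1 zero 0≤x x≤1 = ≤-reflexive refl
  ^-≤1 {x} (suc k) 0≤x x≤1 = 0≤⇒≤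
    (0≤+ (≤⇒0≤ (^-≤1 k 0≤x x≤1)) (0≤* (0≤^ k 0≤x) (≤⇒0≤ x≤1)))
    (solve 2 (λ x p → (:1 :- p) :+ p :* (:1 :- x) := :1 :- x :* p) refl x (x ^ k))

  module _ {a b : Carrier} (0≤a : 0# ≤ a) (a≤b : a ≤ b) where

    private
      0≤b : 0# ≤ b
      0≤b = ≤-trans 0≤a a≤b

    -- This and `^-difference-≥` replace the mean value theorem. Both follow by induction from
    -- b^{k+2} - a^{k+2} = b (b^{k+1} - a^{k+1}) + a^{k+1} (b - a) and the same identity with a and
    -- b exchanged.
    ^-difference-≤ : ∀ k → b ^ suc k - a ^ suc k ≤ fromℕ (suc k) * b ^ k * (b - a)
    ^-difference-≤ zero = ≤-reflexive
      (solve 2 (λ a b → b :* :1 :- a :* :1 := (:1 :+ :0) :* :1 :* (b :- a)) refl a b)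
    ^-difference-≤ (suc k) = 0≤⇒≤
      (0≤+ (0≤* 0≤b (≤⇒0≤ (^-difference-≤ k))) (0≤* (≤⇒0≤ (^-mono-≤ (suc k) 0≤a a≤b)) (≤⇒0≤ a≤b)))
      (solve 5 (λ a b p q n →
        b :* ((:1 :+ n) :* q :* (b :- a) :- (b :* q :- a :* p)) :+ (b :* q :- a :* p) :* (b :- a)
          := (:1 :+ (:1 :+ n)) :* (b :* q) :* (b :- a) :- (b :* (b :* q) :- a :* (a :* p)))
        refl a b (a ^ k) (b ^ k) (fromℕ k))

    ^-difference-≥ : ∀ k → fromℕ (suc k) * a ^ k * (b - a) ≤ b ^ suc k - a ^ suc k
    ^-difference-≥ zero = ≤-reflexive
      (solve 2 (λ a b → (:1 :+ :0) :* :1 :* (b :- a) := b :* :1 :- a :* :1) refl a b)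
    ^-difference-≥ (suc k) = 0≤⇒≤
      (0≤+ (0≤* 0≤a (≤⇒0≤ (^-difference-≥ k))) (0≤* (≤⇒0≤ (^-mono-≤ (suc k) 0≤a a≤b)) (≤⇒0≤ a≤b)))
      (solve 5 (λ a b p q n →
        a :* ((b :* q :- a :* p) :- (:1 :+ n) :* p :* (b :- a)) :+ (b :* q :- a :* p) :* (b :- a)
          := (b :* (b :* q) :- a :* (a :* p)) :- (:1 :+ (:1 :+ n)) :* (a :* p) :* (b :- a))
        refl a b (a ^ k) (b ^ k) (fromℕ k))

    ^-lipschitz : b ≤ 1# → ∀ k → b ^ k - a ^ k ≤ fromℕ k * (b - a)
    ^-lipschitz b≤1 zero = ≤-reflexive
      (solve 1 (λ d → :1 :- :1 := :0 :* d) refl (b - a))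
    ^-lipschitz b≤1 (suc k) = 0≤⇒≤
      (0≤+ (0≤+ (0≤* 0≤b (≤⇒0≤ (^-lipschitz b≤1 k)))
                (0≤* (≤⇒0≤ b≤1) (0≤* (0≤fromℕ k) (≤⇒0≤ a≤b))))
           (0≤* (≤⇒0≤ a≤b) (≤⇒0≤ (^-≤1 k 0≤a (≤-trans a≤b b≤1)))))
      (solve 5 (λ a b p q n →
        b :* (n :* (b :- a) :- (q :- p)) :+ (:1 :- b) :* (n :* (b :- a)) :+ (b :- a) :* (:1 :- p)
          := (:1 :+ n) :* (b :- a) :- (b :* q :- a :* p))
        refl a b (a ^ k) (b ^ k) (fromℕ k))

  1^ : ∀ n → 1# ^ n ≈ 1#
  1^ zero    = refl
  1^ (suc n) = trans (*-identityˡ _) (1^ n)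

  -- With d = b - a, both the tagged term and the increment of the antiderivative lie between (k+1)
  -- a^k d and (k+1) b^k d. These differ by at most (k+1) k d², since t^k has Lipschitz constant k
  -- on [0,1]; hence the value of `M`.
  Integral-^ : ∀ k → Integral (λ t → fromℕ (suc k) * t ^ k) 1#
  Integral-^ k = record
    { F      = _^ suc k
    ; F-cong = ^-congˡ (suc k)
    ; M      = suc k ℕ.* k
    ; approx = λ 0≤a a≤t t≤b b≤1 → approximates 0≤a a≤t t≤b b≤1
    ; total  = trans (+-cong (1^ (suc k)) (-‿cong (zeroˡ _))) (x-0≈x 1#)
    }
    where
    module _ {a t b : Carrier} (0≤a : 0# ≤ a) (a≤t : a ≤ t) (t≤b : t ≤ b) (b≤1 : b ≤ 1#) where
      private
        a≤b : a ≤ b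
        a≤b = ≤-trans a≤t t≤b
        d Δ : Carrier
        d = b - a
        Δ = b ^ suc k - a ^ suc k
        N : Carrier
        N = fromℕ (suc k)
        0≤d : 0# ≤ d
        0≤d = ≤⇒0≤ a≤b

      approximates : Within (fromℕ (suc k ℕ.* k) * (d * d)) (N * t ^ k * d) Δ
      approximates =
        ≤-respʳ ε≈ (0≤⇒≤
          (0≤+ (0≤+ (0≤* (0≤* (0≤fromℕ (suc k)) (≤⇒0≤ (^-lipschitz 0≤a a≤b b≤1 k))) 0≤d)
                    (0≤* (0≤* (0≤fromℕ (suc k)) (≤⇒0≤ (^-mono-≤ k (≤-trans 0≤a a≤t) t≤b))) 0≤d))
               (≤⇒0≤ (^-difference-≥ 0≤a a≤b k)))
          (solve 7 (λ N n d Δ p r q →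
            N :* (n :* d :- (q :- p)) :* d :+ N :* (q :- r) :* d :+ (Δ :- N :* p :* d)
              := N :* n :* (d :* d) :- (N :* r :* d :- Δ))
            refl N (fromℕ k) d Δ (a ^ k) (t ^ k) (b ^ k))) ,
        ≤-respʳ ε≈ (0≤⇒≤
          (0≤+ (0≤+ (0≤* (0≤* (0≤fromℕ (suc k)) (≤⇒0≤ (^-lipschitz 0≤a a≤b b≤1 k))) 0≤d)
                    (0≤* (0≤* (0≤fromℕ (suc k)) (≤⇒0≤ (^-mono-≤ k 0≤a a≤t))) 0≤d))
               (≤⇒0≤ (^-difference-≤ 0≤a a≤b k)))
          (solve 7 (λ N n d Δ p r q →
            N :* (n :* d :- (q :- p)) :* d :+ N :* (r :- p) :* d :+ (N :* q :* d :- Δ)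
              := N :* n :* (d :* d) :- (Δ :- N :* r :* d))
            refl N (fromℕ k) d Δ (a ^ k) (t ^ k) (b ^ k)))
        where
        ε≈ : N * fromℕ k * (d * d) ≈ fromℕ (suc k ℕ.* k) * (d * d)
        ε≈ = *-congʳ (sym (fromℕ-* (suc k) k))

  -- From local estimates to Riemann sums.

  monotone⇒first≤last : ∀ n (p : Fin (suc n) → Carrier) →
    (∀ i → p (inject₁ i) ≤ p (suc i)) → p zero ≤ p (Fin.fromℕ n)
  monotone⇒first≤last zero    p mono = ≤-reflexive refl
  monotone⇒first≤last (suc n) p mono =
    ≤-trans (mono zero) (monotone⇒first≤last n (p ∘ suc) (mono ∘ suc))

  module _ {f : Carrier → Carrier} {I : Carrier} (∫f : Integral f I) {δ : Carrier} where

    -- The error is proportional to the length of the stretch covered, so it adds up along the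
    -- induction together with the telescoping increments of `F`. On one interval of width w it
    -- comes from w² ≤ δ w.
    riemannSum-approx : ∀ n (p : Fin (suc n) → Carrier) (t : Fin n → Carrier) →
      0# ≤ p zero → p (Fin.fromℕ n) ≤ 1# →
      (∀ i → p (inject₁ i) ≤ t i) → (∀ i → t i ≤ p (suc i)) →
      (∀ i → p (suc i) - p (inject₁ i) ≤ δ) →
      Within (fromℕ (M ∫f) * δ * (p (Fin.fromℕ n) - p zero))
             (sum λ i → f (t i) * (p (suc i) - p (inject₁ i)))
             (F ∫f (p (Fin.fromℕ n)) - F ∫f (p zero))
    riemannSum-approx zero p t _ _ _ _ _ =
      ≤-reflexive (solve 3 (λ F m p → :0 :- (F :- F) := m :* (p :- p)) refl _ _ _) ,
      ≤-reflexive (solve 3 (λ F m p → F :- F :- :0 := m :* (p :- p)) refl _ _ _)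
    riemannSum-approx (suc n) p t 0≤p₀ pₙ≤1 p≤t t≤p w≤δ = Within-cong
      (solve 4 (λ m x y z → m :* (y :- x) :+ m :* (z :- y) := m :* (z :- x)) refl _ _ _ _)
      refl
      (solve 3 (λ x y z → (y :- x) :+ (z :- y) := z :- x) refl _ _ _)
      (Within-+
        (Within-≤ (0≤⇒≤
          (0≤* (0≤fromℕ (M ∫f)) (0≤* (≤⇒0≤ (w≤δ zero)) (≤⇒0≤ p₀≤p₁)))
          (solve 3 (λ m δ w → m :* ((δ :- w) :* w) := m :* δ :* w :- m :* (w :* w)) refl _ _ _))
          (approx ∫f 0≤p₀ (p≤t zero) (t≤p zero)
            (≤-trans (monotone⇒first≤last n (p ∘ suc) (λ i → ≤-trans (p≤t (suc i)) (t≤p (suc i)))) pₙ≤1)))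
        (riemannSum-approx n (p ∘ suc) (t ∘ suc) (≤-trans 0≤p₀ p₀≤p₁) pₙ≤1
          (p≤t ∘ suc) (t≤p ∘ suc) (w≤δ ∘ suc)))
      where
      p₀≤p₁ : p zero ≤ p (suc zero)
      p₀≤p₁ = ≤-trans (p≤t zero) (t≤p zero)

  isIntegral : ∀ {f I} → Integral f I → IsIntegral f 0# 1# I
  isIntegral {f} {I} ∫f ε 0<ε = δ , /ℕ-pos (suc (M ∫f)) 0<ε , λ P w≤δ →
    let open TaggedPartition P in
    Within-≤ Mδ≤ε (Within-cong
      (trans (*-congˡ (trans (+-cong last (-‿cong first)) (x-0≈x 1#))) (*-identityʳ _))
      refl
      (trans (+-cong (F-cong ∫f last) (-‿cong (F-cong ∫f first))) (total ∫f))
      (riemannSum-approx ∫f size point tag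
        (≤-reflexive (sym first)) (≤-reflexive last) point≤tag tag≤point w≤δ))
    where
    δ : Carrier
    -- The successor keeps the divisor nonzero: `M` is 0 for the zero function.
    δ = ε /ℕ suc (M ∫f)

    Mδ≤ε : fromℕ (M ∫f) * δ ≤ ε
    Mδ≤ε = 0≤⇒≤ (<⇒≤ (/ℕ-pos (suc (M ∫f)) 0<ε)) (begin
      δ                                    ≈⟨ solve 2 (λ m δ → δ := (:1 :+ m) :* δ :- m :* δ) refl _ _ ⟩
      fromℕ (suc (M ∫f)) * δ - fromℕ (M ∫f) * δ  ≈⟨ +-congʳ (*-/ℕ (suc (M ∫f)) ε) ⟩
      ε - fromℕ (M ∫f) * δ                 ∎)

-- The commutative ring of formal power series.

module SeriesAlgebra {c ℓ₁ ℓ₂} (ℝ : RealField c ℓ₁ ℓ₂) where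

  open RealField ℝ
  open CauchyPolynomials ℝ
  open OrderedField ℝ
  open CommutativeRing commutativeRing using (semiring)
  open SemiringExp semiring using (^-congˡ)
  open SetoidReasoning setoid

  infix 4 _≋_
  record _≋_ (f g : Series) : Set ℓ₁ where
    constructor pointwise
    field at : ∀ n → f n ≈ g n
  open _≋_ public

  -ˢ_ : Series → Series
  (-ˢ f) n = - f n

  0ˢ : Series
  0ˢ _ = 0#

  scale : Carrier → Series → Series
  scale a f n = a * f n

  ≋-refl : ∀ {f} → f ≋ f
  ≋-refl = pointwise λ _ → refl

  ≋-sym : ∀ {f g} → f ≋ g → g ≋ f
  ≋-sym p = pointwise λ n → sym (at p n)

  ≋-trans : ∀ {f g h} → f ≋ g → g ≋ h → f ≋ h
  ≋-trans p q = pointwise λ n → trans (at p n) (at q n)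

  +ˢ-cong : ∀ {f f′ g g′} → f ≋ f′ → g ≋ g′ → f +ˢ g ≋ f′ +ˢ g′
  +ˢ-cong p q = pointwise λ n → +-cong (at p n) (at q n)

  *ˢ-cong : ∀ {f f′ g g′} → f ≋ f′ → g ≋ g′ → f *ˢ g ≋ f′ *ˢ g′
  *ˢ-cong p q = pointwise (go p q)
    where
    go : ∀ {f f′ g g′} → f ≋ f′ → g ≋ g′ → ∀ n → (f *ˢ g) n ≈ (f′ *ˢ g′) n
    go p q zero    = +-congʳ (*-cong (at p 0) (at q 0))
    go p q (suc n) = +-cong (*-cong (at p 0) (at q (suc n)))
                            (go (pointwise λ k → at p (suc k)) q n)

  *ˢ-distribʳ : ∀ h f g → (f +ˢ g) *ˢ h ≋ f *ˢ h +ˢ g *ˢ h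
  *ˢ-distribʳ h f g = pointwise (go f g)
    where
    go : ∀ f g n → ((f +ˢ g) *ˢ h) n ≈ (f *ˢ h +ˢ g *ˢ h) n
    go f g zero = solve 3 (λ f g h → (f :+ g) :* h :+ :0 := (f :* h :+ :0) :+ (g :* h :+ :0))
      refl (f 0) (g 0) (h 0)
    go f g (suc n) = trans (+-congˡ (go (tail f) (tail g) n))
      (solve 5 (λ f g h x y → (f :+ g) :* h :+ (x :+ y) := (f :* h :+ x) :+ (g :* h :+ y)) refl _ _ _ _ _)

  -- By definition a product unfolds along its left factor. This mirror recursion along the right
  -- factor is what the induction for commutativity needs.
  *ˢ-unfoldʳ : ∀ f g n → (f *ˢ g) (suc n) ≈ g 0 * f (suc n) + (f *ˢ tail g) n
  *ˢ-unfoldʳ f g zero = solve 4 (λ f₀ f₁ g₀ g₁ →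
    f₀ :* g₁ :+ (f₁ :* g₀ :+ :0) := g₀ :* f₁ :+ (f₀ :* g₁ :+ :0)) refl _ _ _ _
  *ˢ-unfoldʳ f g (suc n) = trans (+-congˡ (*ˢ-unfoldʳ (tail f) g n))
    (solve 3 (λ x y z → x :+ (y :+ z) := y :+ (x :+ z)) refl _ _ _)

  *ˢ-comm : ∀ f g → f *ˢ g ≋ g *ˢ f
  *ˢ-comm f g = pointwise (go f)
    where
    go : ∀ f n → (f *ˢ g) n ≈ (g *ˢ f) n
    go f zero    = +-congʳ (*-comm _ _)
    go f (suc n) = trans (+-congˡ (go (tail f) n)) (sym (*ˢ-unfoldʳ g f n))

  scale-*ˢ : ∀ a f g → scale a f *ˢ g ≋ scale a (f *ˢ g)
  scale-*ˢ a f g = pointwise (go f)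
    where
    go : ∀ f n → (scale a f *ˢ g) n ≈ a * (f *ˢ g) n
    go f zero = solve 3 (λ a f g → a :* f :* g :+ :0 := a :* (f :* g :+ :0)) refl _ _ _
    go f (suc n) = trans (+-congˡ (go (tail f) n))
      (solve 4 (λ a f g x → a :* f :* g :+ a :* x := a :* (f :* g :+ x)) refl _ _ _ _)

  *ˢ-assoc : ∀ f g h → (f *ˢ g) *ˢ h ≋ f *ˢ (g *ˢ h)
  *ˢ-assoc f g h = pointwise (go f)
    where
    go : ∀ f n → ((f *ˢ g) *ˢ h) n ≈ (f *ˢ (g *ˢ h)) n
    go f zero = solve 3 (λ f g h → (f :* g :+ :0) :* h :+ :0 := f :* (g :* h :+ :0) :+ :0) refl _ _ _
    go f (suc n) = trans
      (+-congˡ (trans (at (*ˢ-distribʳ h (scale (f 0) (tail g)) (tail f *ˢ g)) n)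
                      (+-cong (at (scale-*ˢ (f 0) (tail g) h) n) (go (tail f) n))))
      (solve 5 (λ f g h x y → (f :* g :+ :0) :* h :+ (f :* x :+ y) := f :* (g :* h :+ x) :+ y)
        refl _ _ _ _ _)

  0ˢ-*ˢ : ∀ f → 0ˢ *ˢ f ≋ 0ˢ
  0ˢ-*ˢ f = pointwise go
    where
    go : ∀ n → (0ˢ *ˢ f) n ≈ 0#
    go zero    = trans (+-identityʳ _) (zeroˡ _)
    go (suc n) = trans (+-cong (zeroˡ _) (go n)) (+-identityʳ 0#)

  const-*ˢ : ∀ a f → const a *ˢ f ≋ scale a f
  const-*ˢ a f = pointwise λ where
    zero    → +-identityʳ _
    (suc n) → trans (+-congˡ (at (0ˢ-*ˢ f) n)) (+-identityʳ _)

  *ˢ-identityˡ : ∀ f → const 1# *ˢ f ≋ f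
  *ˢ-identityˡ f = pointwise λ n → trans (at (const-*ˢ 1# f) n) (*-identityˡ _)

  infixl 7 _⊛_

  -- Keeping the product opaque stops Agda from unfolding it into sums when it
  -- compares series.
  opaque
    _⊛_ : Series → Series → Series
    _⊛_ = _*ˢ_

    ⊛≋*ˢ : ∀ f g → f ⊛ g ≋ f *ˢ g
    ⊛≋*ˢ f g = ≋-refl

    isCommutativeRing-⊛ : IsCommutativeRing _≋_ _+ˢ_ _⊛_ -ˢ_ 0ˢ (const 1#)
    isCommutativeRing-⊛ = record
      { isRing = record
        { +-isAbelianGroup = record
          { isGroup = record
            { isMonoid = record
              { isSemigroup = record
                { isMagma = record
                  { isEquivalence = record { refl = ≋-refl ; sym = ≋-sym ; trans = ≋-trans }
                  ; ∙-cong = +ˢ-cong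
                  }
                ; assoc = λ f g h → pointwise λ n → +-assoc _ _ _
                }
              ; identity = (λ f → pointwise λ n → +-identityˡ _) ,
                           (λ f → pointwise λ n → +-identityʳ _)
              }
            ; inverse = (λ f → pointwise λ n → -‿inverseˡ _) ,
                        (λ f → pointwise λ n → -‿inverseʳ _)
            ; ⁻¹-cong = λ p → pointwise λ n → -‿cong (at p n)
            }
          ; comm = λ f g → pointwise λ n → +-comm _ _
          }
        ; *-cong = *ˢ-cong
        ; *-assoc = *ˢ-assoc
        ; *-identity = *ˢ-identityˡ , λ f → ≋-trans (*ˢ-comm f (const 1#)) (*ˢ-identityˡ f)
        ; distrib = (λ h f g → ≋-trans (*ˢ-comm h (f +ˢ g)) (≋-trans (*ˢ-distribʳ h f g)
                      (+ˢ-cong (*ˢ-comm f h) (*ˢ-comm g h)))) ,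
                    *ˢ-distribʳ
        }
      ; *-comm = *ˢ-comm
      }

  seriesRing : CommutativeRing c ℓ₁
  seriesRing = record { isCommutativeRing = isCommutativeRing-⊛ }

  open CommutativeRing seriesRing public using () renaming
    ( +-congˡ to +ˢ-congˡ; +-congʳ to +ˢ-congʳ; -‿cong to -ˢ-cong
    ; +-identityˡ to +ˢ-identityˡ
    ; *-cong to ⊛-cong; *-congˡ to ⊛-congˡ; *-congʳ to ⊛-congʳ
    ; *-assoc to ⊛-assoc; *-comm to ⊛-comm
    ; *-identityˡ to ⊛-identityˡ; *-identityʳ to ⊛-identityʳ; zeroˡ to ⊛-zeroˡ
    )

  module SeriesSolver = ℤ-RingSolver seriesRing
  open SeriesSolver public using () renaming
    (solve to solveˢ; _:=_ to _≔_; _:+_ to _⊞_; _:*_ to _⊡_; _:-_ to _⊟_; :-_ to ⊟_; :0 to 𝟘; :1 to 𝟙)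

  const-⊛ : ∀ a f → const a ⊛ f ≋ scale a f
  const-⊛ a f = ≋-trans (⊛≋*ˢ (const a) f) (const-*ˢ a f)

  ⊛₀ : ∀ f g → (f ⊛ g) 0 ≈ f 0 * g 0
  ⊛₀ f g = trans (at (⊛≋*ˢ f g) 0) (+-identityʳ _)

  const-cong : ∀ {a b} → a ≈ b → const a ≋ const b
  const-cong a≈b = pointwise λ where
    zero    → a≈b
    (suc n) → refl

  const-+ : ∀ a b → const (a + b) ≋ const a +ˢ const b
  const-+ a b = pointwise λ where
    zero    → refl
    (suc n) → sym (+-identityˡ 0#)

  const-* : ∀ a b → const (a * b) ≋ const a ⊛ const b
  const-* a b = ≋-sym (≋-trans (const-⊛ a (const b)) (pointwise λ where
    zero    → refl
    (suc n) → zeroʳ a))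

  const-neg : ∀ a → const (- a) ≋ -ˢ const a
  const-neg a = pointwise λ where
    zero    → refl
    (suc n) → solve 0 (:0 := :- :0) refl

  const-0 : const 0# ≋ 0ˢ
  const-0 = pointwise λ where
    zero    → refl
    (suc n) → refl

  tail-X : tail X ≋ const 1#
  tail-X = pointwise λ where
    zero    → refl
    (suc n) → refl

  X-⊛-suc : ∀ f n → (X ⊛ f) (suc n) ≈ f n
  X-⊛-suc f n = begin
    (X ⊛ f) (suc n)                   ≈⟨ at (⊛≋*ˢ X f) (suc n) ⟩
    0# * f (suc n) + (tail X *ˢ f) n  ≈⟨ +-cong (zeroˡ _) (at (*ˢ-cong tail-X (≋-refl {f})) n) ⟩
    0# + (const 1# *ˢ f) n            ≈⟨ +-identityˡ _ ⟩
    (const 1# *ˢ f) n                 ≈⟨ at (*ˢ-identityˡ f) n ⟩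
    f n                               ∎

  head+X⊛tail : ∀ f → f ≋ const (f 0) +ˢ X ⊛ tail f
  head+X⊛tail f = pointwise λ where
    zero    → sym (trans (+-congˡ (trans (⊛₀ X (tail f)) (zeroˡ _))) (+-identityʳ _))
    (suc n) → sym (trans (+-identityˡ _) (X-⊛-suc (tail f) n))

  X⊛tail : ∀ f → f 0 ≈ 0# → X ⊛ tail f ≋ f
  X⊛tail f f₀≈0 = ≋-sym (≋-trans (head+X⊛tail f) (≋-trans
    (+ˢ-congʳ (≋-trans (const-cong f₀≈0) const-0)) (+ˢ-identityˡ (X ⊛ tail f))))

  X-cancel : ∀ {f g} → X ⊛ f ≋ X ⊛ g → f ≋ g
  X-cancel {f} {g} p = pointwise λ n →
    trans (sym (X-⊛-suc f n)) (trans (at p (suc n)) (X-⊛-suc g n))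

  divide-⊛ : ∀ f g (g₀#0 : g 0 # 0#) → divide f g g₀#0 ⊛ g ≋ f
  divide-⊛ f g g₀#0 = ≋-trans (⊛≋*ˢ (divide f g g₀#0) g) (pointwise (go f))
    where
    q₀ : Series → Carrier
    q₀ f = f 0 * inverse g₀#0
    go : ∀ f n → (divide f g g₀#0 *ˢ g) n ≈ f n
    go f zero = begin
      f 0 * inverse g₀#0 * g 0 + 0#  ≈⟨ solve 3 (λ f i g → f :* i :* g :+ :0 := f :* (i :* g)) refl _ _ _ ⟩
      f 0 * (inverse g₀#0 * g 0)     ≈⟨ *-congˡ (inverse-* g₀#0) ⟩
      f 0 * 1#                       ≈⟨ *-identityʳ _ ⟩
      f 0                            ∎
    go f (suc n) = begin
      q₀ f * g (suc n) + (divide f′ g g₀#0 *ˢ g) n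
        ≈⟨ +-congˡ (go f′ n) ⟩
      q₀ f * g (suc n) + (f (suc n) - (const (q₀ f) *ˢ tail g) n)
        ≈⟨ +-congˡ (+-congˡ (-‿cong (at (const-*ˢ (q₀ f) (tail g)) n))) ⟩
      q₀ f * g (suc n) + (f (suc n) - q₀ f * g (suc n))
        ≈⟨ solve 2 (λ x y → x :+ (y :- x) := y) refl _ _ ⟩
      f (suc n) ∎
      where
      f′ : Series
      f′ = tail f -ˢ const (q₀ f) *ˢ tail g

  ⊛-cancelʳ : ∀ {f f′} g → g 0 # 0# → f ⊛ g ≋ f′ ⊛ g → f ≋ f′
  ⊛-cancelʳ {f} {f′} g g₀#0 fg≋f′g = ≋-trans (≋-sym (lemma f)) (≋-trans (⊛-congʳ fg≋f′g) (lemma f′))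
    where
    g⁻¹ : Series
    g⁻¹ = divide (const 1#) g g₀#0
    lemma : ∀ f → f ⊛ g ⊛ g⁻¹ ≋ f
    lemma f = ≋-trans (⊛-assoc f g g⁻¹) (≋-trans
      (⊛-congˡ (≋-trans (⊛-comm g g⁻¹) (divide-⊛ (const 1#) g g₀#0)))
      (⊛-identityʳ f))

  -- Formal differentiation and the exponential series.

  D : Series → Series
  D f n = fromℕ (suc n) * f (suc n)

  D-cong : ∀ {f g} → f ≋ g → D f ≋ D g
  D-cong p = pointwise λ n → *-congˡ (at p (suc n))

  D-+ : ∀ f g → D (f +ˢ g) ≋ D f +ˢ D g
  D-+ f g = pointwise λ n → distribˡ _ _ _

  D-const : ∀ a → D (const a) ≋ 0ˢ
  D-const a = pointwise λ n → zeroʳ _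

  -- (f g)′ is compared with f′ g + f g′ after removing the constant term f 0 of f.
  D-⊛ : ∀ f g → D (f ⊛ g) ≋ D f ⊛ g +ˢ f ⊛ D g
  D-⊛ f g = ≋-trans (D-cong (⊛≋*ˢ f g)) (≋-trans (pointwise (go f))
    (≋-sym (+ˢ-cong (⊛≋*ˢ (D f) g) (⊛≋*ˢ f (D g)))))
    where
    go : ∀ f n → D (f *ˢ g) n ≈ (D f *ˢ g) n + (f *ˢ D g) n
    go f zero = solve 4 (λ f₀ f₁ g₀ g₁ →
      (:1 :+ :0) :* (f₀ :* g₁ :+ (f₁ :* g₀ :+ :0))
        := ((:1 :+ :0) :* f₁ :* g₀ :+ :0) :+ (f₀ :* ((:1 :+ :0) :* g₁) :+ :0)) refl _ _ _ _
    go f (suc n) = begin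
      (1# + N) * (f 0 * g (suc (suc n)) + h (suc n))
        ≈⟨ solve 5 (λ f₀ f₁ g N h → (:1 :+ N) :* (f₀ :* g :+ h) :=
             f₀ :* ((:1 :+ N) :* g) :+ N :* h :+ h) refl (f 0) 0# (g (suc (suc n))) N (h (suc n)) ⟩
      f 0 * tail (D g) n + D h n + h (suc n)
        ≈⟨ +-congʳ (+-congˡ (go (tail f) n)) ⟩
      f 0 * tail (D g) n + ((D (tail f) *ˢ g) n + (tail f *ˢ D g) n)
        + (f 1 * g (suc n) + (tail (tail f) *ˢ g) n)
        ≈⟨ solve 6 (λ f₀D Dtf tfD f₁ g ttf →
             f₀D :+ (Dtf :+ tfD) :+ (f₁ :* g :+ ttf)
               := ((:1 :+ :0) :* f₁ :* g :+ (Dtf :+ ttf)) :+ (f₀D :+ tfD)) refl _ _ _ _ _ _ ⟩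
      (D f 0 * g (suc n) + ((D (tail f) *ˢ g) n + (tail (tail f) *ˢ g) n))
        + (f *ˢ D g) (suc n)
        ≈⟨ +-congʳ (+-congˡ (at (*ˢ-distribʳ g (D (tail f)) (tail (tail f))) n)) ⟨
      (D f 0 * g (suc n) + ((D (tail f) +ˢ tail (tail f)) *ˢ g) n) + (f *ˢ D g) (suc n)
        ≈⟨ +-congʳ (+-congˡ (at (*ˢ-cong tail-D (≋-refl {g})) n)) ⟩
      (D f *ˢ g) (suc n) + (f *ˢ D g) (suc n) ∎
      where
      N : Carrier
      N = fromℕ (suc n)
      h : Series
      h = tail f *ˢ g
      tail-D : D (tail f) +ˢ tail (tail f) ≋ tail (D f)
      tail-D = pointwise λ k →
        solve 2 (λ m x → m :* x :+ x := (:1 :+ m) :* x) refl (fromℕ (suc k)) (f (suc (suc k)))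

  D-const-⊛ : ∀ a f → D (const a ⊛ f) ≋ const a ⊛ D f
  D-const-⊛ a f = ≋-trans (D-⊛ (const a) f) (≋-trans
    (+ˢ-congʳ (≋-trans (⊛-congʳ (D-const a)) (⊛-zeroˡ f))) (+ˢ-identityˡ (const a ⊛ D f)))

  -- The equation f′ = a f determines coefficient n + 1 from coefficient n, because n + 1 can be
  -- cancelled. The laws of `exp` thereby reduce to the Leibniz rule, without the binomial theorem.
  D-unique : ∀ {f g} a → f 0 ≈ g 0 → D f ≋ const a ⊛ f → D g ≋ const a ⊛ g → f ≋ g
  D-unique {f} {g} a f₀≈g₀ Df Dg = pointwise go
    where
    go : ∀ n → f n ≈ g n
    go zero    = f₀≈g₀
    go (suc n) = *-cancel-fromℕ (suc n) (begin
      D f n             ≈⟨ trans (at Df n) (at (const-⊛ a f) n) ⟩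
      a * f n           ≈⟨ *-congˡ (go n) ⟩
      a * g n           ≈⟨ trans (at Dg n) (at (const-⊛ a g) n) ⟨
      D g n             ∎)

  !⁻¹ : ℕ → Carrier
  !⁻¹ k = inverse (fromℕ#0 (k !) {{k ℕ.!≢0}})

  !*!⁻¹ : ∀ k → fromℕ (k !) * !⁻¹ k ≈ 1#
  !*!⁻¹ k = trans (*-comm _ _) (inverse-* (fromℕ#0 (k !) {{k ℕ.!≢0}}))

  suc*!⁻¹ : ∀ k → fromℕ (suc k) * !⁻¹ (suc k) ≈ !⁻¹ k
  suc*!⁻¹ k = *-cancel-fromℕ (k !) {{k ℕ.!≢0}} (begin
    fromℕ (k !) * (fromℕ (suc k) * !⁻¹ (suc k))
      ≈⟨ solve 3 (λ x y z → x :* (y :* z) := y :* x :* z) refl _ _ _ ⟩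
    fromℕ (suc k) * fromℕ (k !) * !⁻¹ (suc k)   ≈⟨ *-congʳ (fromℕ-* (suc k) (k !)) ⟨
    fromℕ (suc k !) * !⁻¹ (suc k)               ≈⟨ !*!⁻¹ (suc k) ⟩
    1#                                          ≈⟨ !*!⁻¹ k ⟨
    fromℕ (k !) * !⁻¹ k                         ∎)

  exp₀ : ∀ a → exp a 0 ≈ 1#
  exp₀ a = /ℕ-1 1#

  D-exp : ∀ a → D (exp a) ≋ const a ⊛ exp a
  D-exp a = ≋-trans (pointwise λ k → begin
    fromℕ (suc k) * (a * a ^ k * !⁻¹ (suc k))
      ≈⟨ solve 4 (λ n a p i → n :* (a :* p :* i) := a :* (p :* (n :* i))) refl _ _ _ _ ⟩
    a * (a ^ k * (fromℕ (suc k) * !⁻¹ (suc k)))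
      ≈⟨ *-congˡ (*-congˡ (suc*!⁻¹ k)) ⟩
    a * exp a k ∎)
    (≋-sym (const-⊛ a (exp a)))

  exp-cong : ∀ {a b} → a ≈ b → exp a ≋ exp b
  exp-cong a≈b = pointwise λ k → *-congʳ (^-congˡ k a≈b)

  exp-0 : exp 0# ≋ const 1#
  exp-0 = D-unique 0# (exp₀ 0#) (D-exp 0#) (≋-trans (D-const 1#)
    (≋-sym (≋-trans (⊛-congʳ const-0) (⊛-zeroˡ (const 1#)))))

  exp-+ : ∀ a b → exp a ⊛ exp b ≋ exp (a + b)
  exp-+ a b = D-unique (a + b)
    (trans (⊛₀ (exp a) (exp b)) (trans (*-cong (exp₀ a) (exp₀ b)) (trans (*-identityˡ 1#) (sym (exp₀ (a + b))))))
    (≋-trans (D-⊛ (exp a) (exp b)) (≋-trans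
      (+ˢ-cong (⊛-congʳ (D-exp a)) (⊛-congˡ (D-exp b)))
      (≋-trans
        (solveˢ 4 (λ a b e f → (a ⊡ e) ⊡ f ⊞ e ⊡ (b ⊡ f) ≔ (a ⊞ b) ⊡ (e ⊡ f)) ≋-refl
          (const a) (const b) (exp a) (exp b))
        (⊛-congʳ (≋-sym (const-+ a b))))))
    (D-exp (a + b))

-- Products of factors D - a.

module DifferentialOperators {c ℓ₁ ℓ₂} (ℝ : RealField c ℓ₁ ℓ₂) where

  open RealField ℝ
  open CauchyPolynomials ℝ
  open OrderedField ℝ
  open SeriesAlgebra ℝ

  -- Π a n = (D − a) (D − a − 1) ⋯ (D − a − n + 1).
  Δ : Carrier → Series → Series
  Δ a f = D f -ˢ const a ⊛ f

  Π : Carrier → ℕ → Series → Series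
  Π a zero    f = f
  Π a (suc n) f = Π (a + 1#) n (Δ a f)

  Δ-cong : ∀ {a b f g} → a ≈ b → f ≋ g → Δ a f ≋ Δ b g
  Δ-cong a≈b f≋g = +ˢ-cong (D-cong f≋g) (-ˢ-cong (⊛-cong (const-cong a≈b) f≋g))

  Δ-+ : ∀ a f g → Δ a (f +ˢ g) ≋ Δ a f +ˢ Δ a g
  Δ-+ a f g = ≋-trans (+ˢ-congʳ (D-+ f g))
    (solveˢ 5 (λ a f g f′ g′ → (f′ ⊞ g′) ⊟ a ⊡ (f ⊞ g) ≔ (f′ ⊟ a ⊡ f) ⊞ (g′ ⊟ a ⊡ g)) ≋-refl
      (const a) f g (D f) (D g))

  Δ-const-⊛ : ∀ a b f → Δ a (const b ⊛ f) ≋ const b ⊛ Δ a f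
  Δ-const-⊛ a b f = ≋-trans (+ˢ-congʳ (D-const-⊛ b f))
    (solveˢ 4 (λ a b f f′ → b ⊡ f′ ⊟ a ⊡ (b ⊡ f) ≔ b ⊡ (f′ ⊟ a ⊡ f)) ≋-refl
      (const a) (const b) f (D f))

  D-Δ : ∀ a f → D (Δ a f) ≋ Δ a (D f)
  D-Δ a f = ≋-trans (D-+ (D f) (-ˢ (const a ⊛ f))) (+ˢ-congˡ (≋-trans
    (pointwise λ n → solve 2 (λ n x → n :* (:- x) := :- (n :* x)) refl _ _)
    (-ˢ-cong (D-const-⊛ a f))))

  -- In expanded form only the sum and the product of the two roots remain. This gives commutativity
  -- at once, and lets operators with related pairs of roots be compared.
  Δ-Δ : ∀ a b f → Δ a (Δ b f) ≋ D (D f) -ˢ const (a + b) ⊛ D f +ˢ const (a * b) ⊛ f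
  Δ-Δ a b f = ≋-trans (+ˢ-congʳ (D-Δ b f)) (≋-trans
    (solveˢ 5 (λ a b f f′ f″ →
      (f″ ⊟ b ⊡ f′) ⊟ a ⊡ (f′ ⊟ b ⊡ f) ≔ f″ ⊟ (a ⊞ b) ⊡ f′ ⊞ (a ⊡ b) ⊡ f)
      ≋-refl (const a) (const b) f (D f) (D (D f)))
    (+ˢ-cong (+ˢ-congˡ (-ˢ-cong (⊛-congʳ (≋-sym (const-+ a b)))))
             (⊛-congʳ (≋-sym (const-* a b)))))

  Δ-comm : ∀ a b f → Δ a (Δ b f) ≋ Δ b (Δ a f)
  Δ-comm a b f = ≋-trans (Δ-Δ a b f) (≋-trans
    (+ˢ-cong (+ˢ-congˡ (-ˢ-cong (⊛-congʳ (const-cong (+-comm a b)))))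
             (⊛-congʳ (const-cong (*-comm a b))))
    (≋-sym (Δ-Δ b a f)))

  -- The exponential shift law, D e^{zX} = e^{zX} (D + z). As e^{zX} has constant term 1, such a
  -- factor translates all roots by -z without affecting the value at X = 0.
  Δ-exp-⊛ : ∀ a z f → Δ a (exp z ⊛ f) ≋ exp z ⊛ Δ (a - z) f
  Δ-exp-⊛ a z f = ≋-trans
    (+ˢ-congʳ (≋-trans (D-⊛ (exp z) f) (+ˢ-congʳ (⊛-congʳ (D-exp z)))))
    (≋-trans
      (solveˢ 5 (λ a z e f f′ → (z ⊡ e ⊡ f ⊞ e ⊡ f′) ⊟ a ⊡ (e ⊡ f) ≔ e ⊡ (f′ ⊟ (a ⊟ z) ⊡ f))
        ≋-refl (const a) (const z) (exp z) f (D f))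
      (⊛-congˡ (+ˢ-congˡ (-ˢ-cong (⊛-congʳ
        (≋-sym (≋-trans (const-+ a (- z)) (+ˢ-congˡ (const-neg z)))))))))

  Π-cong : ∀ {a b} n {f g} → a ≈ b → f ≋ g → Π a n f ≋ Π b n g
  Π-cong zero    a≈b f≋g = f≋g
  Π-cong (suc n) a≈b f≋g = Π-cong n (+-congʳ a≈b) (Δ-cong a≈b f≋g)

  Π-congʳ : ∀ a n {f g} → f ≋ g → Π a n f ≋ Π a n g
  Π-congʳ a n = Π-cong n refl

  Π-+ : ∀ a n f g → Π a n (f +ˢ g) ≋ Π a n f +ˢ Π a n g
  Π-+ a zero    f g = ≋-refl
  Π-+ a (suc n) f g = ≋-trans (Π-congʳ (a + 1#) n (Δ-+ a f g)) (Π-+ (a + 1#) n (Δ a f) (Δ a g))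

  Π-const-⊛ : ∀ a n b f → Π a n (const b ⊛ f) ≋ const b ⊛ Π a n f
  Π-const-⊛ a zero    b f = ≋-refl
  Π-const-⊛ a (suc n) b f =
    ≋-trans (Π-congʳ (a + 1#) n (Δ-const-⊛ a b f)) (Π-const-⊛ (a + 1#) n b (Δ a f))

  Π-- : ∀ a n f g → Π a n (f -ˢ g) ≋ Π a n f -ˢ Π a n g
  Π-- a n f g = ≋-trans (Π-congʳ a n (+ˢ-congˡ (-ˢ≋const⊛ g)))
    (≋-trans (Π-+ a n f (const (- 1#) ⊛ g))
      (+ˢ-congˡ (≋-trans (Π-const-⊛ a n (- 1#) g) (≋-sym (-ˢ≋const⊛ (Π a n g))))))
    where
    -ˢ≋const⊛ : ∀ f → -ˢ f ≋ const (- 1#) ⊛ f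
    -ˢ≋const⊛ f = ≋-sym (≋-trans (const-⊛ (- 1#) f)
      (pointwise λ n → solve 1 (λ x → (:- :1) :* x := :- x) refl (f n)))

  -- `Π` by definition splits off its first root. Because the factors commute, the root at the other
  -- end can be split off instead, which symmetric root sets require.
  Π-last : ∀ a n f → Π a (suc n) f ≋ Π a n (Δ (a + fromℕ n) f)
  Π-last a zero f = Δ-cong (sym (+-identityʳ a)) ≋-refl
  Π-last a (suc n) f = ≋-trans (Π-last (a + 1#) n (Δ a f)) (Π-congʳ (a + 1#) n
    (≋-trans (Δ-comm (a + 1# + fromℕ n) a f) (Δ-cong refl (Δ-cong (+-assoc a 1# (fromℕ n)) ≋-refl))))

  Π-exp-⊛ : ∀ a n z f → Π a n (exp z ⊛ f) ≋ exp z ⊛ Π (a - z) n f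
  Π-exp-⊛ a zero    z f = ≋-refl
  Π-exp-⊛ a (suc n) z f = ≋-trans (Π-congʳ (a + 1#) n (Δ-exp-⊛ a z f))
    (≋-trans (Π-exp-⊛ (a + 1#) n z (Δ (a - z) f))
      (⊛-congˡ (Π-cong n (solve 2 (λ a z → a :+ :1 :- z := a :- z :+ :1) refl a z) ≋-refl)))

  exp-⊛₀ : ∀ z f → (exp z ⊛ f) 0 ≈ f 0
  exp-⊛₀ z f = trans (⊛₀ (exp z) f) (trans (*-congʳ (exp₀ z)) (*-identityˡ _))

  Π-exp : ∀ n z → Π 0# n (exp z) ≋ const (fallingFactorial z n) ⊛ exp z
  Π-exp zero    z = ≋-sym (⊛-identityˡ (exp z))
  Π-exp (suc n) z = ≋-trans (Π-last 0# n (exp z)) (≋-trans (Π-congʳ 0# n Δ-exp)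
    (≋-trans (Π-const-⊛ 0# n (z - fromℕ n) (exp z)) (≋-trans (⊛-congˡ (Π-exp n z))
      (≋-trans (solveˢ 3 (λ x y e → x ⊡ (y ⊡ e) ≔ (y ⊡ x) ⊡ e) ≋-refl
                 (const (z - fromℕ n)) (const (fallingFactorial z n)) (exp z))
               (⊛-congʳ (≋-sym (const-* (fallingFactorial z n) (z - fromℕ n))))))))
    where
    Δ-exp : Δ (0# + fromℕ n) (exp z) ≋ const (z - fromℕ n) ⊛ exp z
    Δ-exp = ≋-trans (+ˢ-cong (D-exp z) (-ˢ-cong (⊛-congʳ (const-cong (+-identityˡ (fromℕ n))))))
      (≋-trans (solveˢ 3 (λ z n e → z ⊡ e ⊟ n ⊡ e ≔ (z ⊟ n) ⊡ e) ≋-refl (const z) (const (fromℕ n)) (exp z))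
        (⊛-congʳ (≋-sym (≋-trans (const-+ z (- fromℕ n)) (+ˢ-congˡ (const-neg (fromℕ n)))))))

  Π-exp₀ : ∀ n z → Π 0# n (exp z) 0 ≈ fallingFactorial z n
  Π-exp₀ n z = trans (at (≋-trans (Π-exp n z) (const-⊛ (fallingFactorial z n) (exp z))) 0)
    (trans (*-congˡ (exp₀ z)) (*-identityʳ _))

  fallingFactorial-fromℕ : ∀ m n → m ℕ.< n → fallingFactorial (fromℕ m) n ≈ 0#
  fallingFactorial-fromℕ m (suc n) m<1+n with ℕ.m<1+n⇒m<n∨m≡n m<1+n
  ... | inj₁ m<n    = trans (*-congʳ (fallingFactorial-fromℕ m n m<n)) (zeroˡ _)
  ... | inj₂ ≡.refl = trans (*-congˡ (-‿inverseʳ _)) (zeroʳ _)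

-- Central factorial numbers as coefficients of a symmetric operator.

module CentralFactorials {c ℓ₁ ℓ₂} (ℝ : RealField c ℓ₁ ℓ₂) where

  open RealField ℝ
  open CauchyPolynomials ℝ
  open OrderedField ℝ
  open SeriesAlgebra ℝ
  open DifferentialOperators ℝ
  open CommutativeRing commutativeRing using (semiring; +-commutativeMonoid)
  open SemiringSum semiring using (sum-cong-≋; *-distribˡ-sum)
  open MonoidSum +-commutativeMonoid using (∑-distrib-+)
  open SetoidReasoning setoid

  sum-last : ∀ n (g : ℕ → Carrier) →
    sum {suc n} (λ i → g (toℕ i)) ≈ sum {n} (λ i → g (toℕ i)) + g n
  sum-last zero    g = trans (+-identityʳ _) (sym (+-identityˡ _))
  sum-last (suc n) g = trans (+-congˡ (sum-last n (λ k → g (suc k)))) (sym (+-assoc _ _ _))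

  centralFactorial-suc : ∀ n → centralFactorial (suc n)
    ≋ X ⊛ (X ⊛ centralFactorial n) -ˢ const (fromℕ n ^ 2) ⊛ centralFactorial n
  centralFactorial-suc n = ≋-trans (≋-sym (⊛≋*ˢ (X *ˢ X -ˢ k) p)) (≋-trans
    (⊛-congʳ {p} (+ˢ-congʳ { -ˢ k} (≋-sym (⊛≋*ˢ X X))))
    (solveˢ 3 (λ x k p → (x ⊡ x ⊟ k) ⊡ p ≔ x ⊡ (x ⊡ p) ⊟ k ⊡ p) ≋-refl X k p))
    where
    k p : Series
    k = const (fromℕ n ^ 2)
    p = centralFactorial n

  2*suc : ∀ m → 2 ℕ.* suc m ≡ suc (suc (2 ℕ.* m))
  2*suc m = ℕ.*-suc 2 m

  u-suc-suc : ∀ n m → u (suc n) (suc m) ≈ u n m - fromℕ n ^ 2 * u n (suc m)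
  u-suc-suc n m = trans (at (centralFactorial-suc n) (2 ℕ.* suc m)) (+-cong
    (trans (reflexive (≡.cong (X ⊛ (X ⊛ p)) (2*suc m)))
      (trans (X-⊛-suc (X ⊛ p) (suc (2 ℕ.* m))) (X-⊛-suc p (2 ℕ.* m))))
    (-‿cong (at (const-⊛ (fromℕ n ^ 2) p) (2 ℕ.* suc m))))
    where
    p : Series
    p = centralFactorial n

  -- The factor for j = 0 is X² itself, so the constant term vanishes from the first product on. For
  -- this reason sums over m may start at 1.
  u-suc-0 : ∀ n → u (suc n) 0 ≈ 0#
  u-suc-0 zero = begin
    u 1 0                                  ≈⟨ at (centralFactorial-suc 0) 0 ⟩
    (X ⊛ (X ⊛ const 1#)) 0 - (const (0# * (0# * 1#)) ⊛ const 1#) 0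
      ≈⟨ +-cong (⊛₀ X (X ⊛ const 1#)) (-‿cong (⊛₀ (const (0# * (0# * 1#))) (const 1#))) ⟩
    0# * (X ⊛ const 1#) 0 - 0# * (0# * 1#) * 1#
      ≈⟨ solve 1 (λ x → :0 :* x :- :0 :* (:0 :* :1) :* :1 := :0) refl _ ⟩
    0#                                     ∎
  u-suc-0 (suc n) = begin
    u (suc (suc n)) 0                      ≈⟨ at (centralFactorial-suc (suc n)) 0 ⟩
    (X ⊛ (X ⊛ p)) 0 - (const k ⊛ p) 0      ≈⟨ +-cong (⊛₀ X (X ⊛ p)) (-‿cong (⊛₀ (const k) p)) ⟩
    0# * (X ⊛ p) 0 - k * u (suc n) 0       ≈⟨ +-congˡ (-‿cong (*-congˡ (u-suc-0 n))) ⟩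
    0# * (X ⊛ p) 0 - k * 0#                ≈⟨ solve 2 (λ x k → :0 :* x :- k :* :0 := :0) refl _ _ ⟩
    0#                                     ∎
    where
    k : Carrier
    k = fromℕ (suc n) ^ 2
    p : Series
    p = centralFactorial (suc n)

  u-vanishes : ∀ n m → n ℕ.< m → u n m ≈ 0#
  u-vanishes zero    (suc m) n<m = refl
  u-vanishes (suc n) (suc m) n<m = begin
    u (suc n) (suc m)                  ≈⟨ u-suc-suc n m ⟩
    u n m - fromℕ n ^ 2 * u n (suc m)  ≈⟨ +-cong (u-vanishes n m (ℕ.≤-pred n<m))
                                            (-‿cong (*-congˡ (u-vanishes n (suc m) (ℕ.m<n⇒m<1+n (ℕ.≤-pred n<m))))) ⟩
    0# - fromℕ n ^ 2 * 0#              ≈⟨ solve 1 (λ k → :0 :- k :* :0 := :0) refl _ ⟩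
    0#                                 ∎

  -- evenDerivative m f is f⁽²ᵐ⁾(0), so central n f is ∏_{j<n} (D² − j²) f at 0 for n ≥ 1.
  evenDerivative : ℕ → Series → Carrier
  evenDerivative m f = fromℕ ((2 ℕ.* m) !) * f (2 ℕ.* m)

  central : ℕ → Series → Carrier
  central n f = Σ[1≤m≤ n ] λ m → u n m * evenDerivative m f

  evenDerivative-suc : ∀ m f → evenDerivative (suc m) f ≈ evenDerivative m (D (D f))
  evenDerivative-suc m f = begin
    evenDerivative (suc m) f
      ≡⟨ ≡.cong (λ k → fromℕ (k !) * f k) (2*suc m) ⟩
    fromℕ (suc (suc k) !) * f (suc (suc k))
      ≈⟨ *-congʳ (trans (fromℕ-* (suc (suc k)) (suc k !)) (*-congˡ (fromℕ-* (suc k) (k !)))) ⟩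
    fromℕ (suc (suc k)) * (fromℕ (suc k) * fromℕ (k !)) * f (suc (suc k))
      ≈⟨ solve 4 (λ a b c x → a :* (b :* c) :* x := c :* (b :* (a :* x))) refl _ _ _ _ ⟩
    evenDerivative m (D (D f)) ∎
    where
    k : ℕ
    k = 2 ℕ.* m

  -- The isolated first summand matters for n = 0 only: there u(0,0) = 1, but the sum defining
  -- `central` is empty. For larger n it vanishes by `u-suc-0`.
  central-suc : ∀ n f → central (suc n) f
    ≈ u n 0 * evenDerivative 0 (D (D f)) + (central n (D (D f)) - fromℕ n ^ 2 * central n f)
  central-suc n f = begin
    central (suc n) f
      ≈⟨ sum-cong-≋ {suc n} (λ i → step (toℕ i)) ⟩
    sum {suc n} (λ i → v (toℕ i) + k * w (toℕ i))
      ≈⟨ ∑-distrib-+ {suc n} (λ i → v (toℕ i)) (λ i → k * w (toℕ i)) ⟩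
    sum {suc n} (λ i → v (toℕ i)) + sum {suc n} (λ i → k * w (toℕ i))
      ≈⟨ +-congˡ (*-distribˡ-sum {suc n} k (λ i → w (toℕ i))) ⟨
    v 0 + central n (D (D f)) + k * sum {suc n} (λ i → w (toℕ i))
      ≈⟨ +-congˡ (*-congˡ (sum-last n w)) ⟩
    v 0 + central n (D (D f)) + k * (central n f + w n)
      ≈⟨ +-congˡ (*-congˡ (+-congˡ (trans (*-congʳ (u-vanishes n (suc n) ℕ.≤-refl)) (zeroˡ _)))) ⟩
    v 0 + central n (D (D f)) + k * (central n f + 0#)
      ≈⟨ solve 4 (λ a b q c → a :+ b :+ (:- q) :* (c :+ :0) := a :+ (b :- q :* c)) refl _ _ _ _ ⟩
    v 0 + (central n (D (D f)) - fromℕ n ^ 2 * central n f) ∎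
    where
    k : Carrier
    k = - (fromℕ n ^ 2)
    v w : ℕ → Carrier
    v m = u n m * evenDerivative m (D (D f))
    w m = u n (suc m) * evenDerivative (suc m) f

    step : ∀ m → u (suc n) (suc m) * evenDerivative (suc m) f ≈ v m + k * w m
    step m = begin
      u (suc n) (suc m) * e
        ≈⟨ *-congʳ (u-suc-suc n m) ⟩
      (u n m - fromℕ n ^ 2 * u n (suc m)) * e
        ≈⟨ solve 4 (λ a q b e → (a :- q :* b) :* e := a :* e :+ (:- q) :* (b :* e)) refl _ _ _ _ ⟩
      u n m * e + k * w m
        ≈⟨ +-congʳ (*-congˡ (evenDerivative-suc m f)) ⟩
      v m + k * w m ∎
      where
      e : Carrier
      e = evenDerivative (suc m) f

  fromℕ-1+2* : ∀ k → fromℕ (suc (2 ℕ.* k)) ≈ 1# + (fromℕ k + fromℕ k)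
  fromℕ-1+2* k = +-congˡ (trans (fromℕ-+ k (k ℕ.+ 0)) (+-congˡ (reflexive (≡.cong fromℕ (ℕ.+-identityʳ k)))))

  Π-symmetric : ∀ k f → Π (- fromℕ (suc k)) (suc (2 ℕ.* suc k)) f
    ≋ Π (- fromℕ k) (suc (2 ℕ.* k)) (Δ (fromℕ (suc k)) (Δ (- fromℕ (suc k)) f))
  Π-symmetric k f = ≋-trans
    (pointwise λ i → reflexive (≡.cong (λ n → Π (- fromℕ (suc k)) (suc n) f i) (2*suc k)))
    (≋-trans (Π-cong (suc (suc (2 ℕ.* k))) (solve 1 (λ k → :- (:1 :+ k) :+ :1 := :- k) refl (fromℕ k)) ≋-refl)
    (≋-trans (Π-last (- fromℕ k) (suc (2 ℕ.* k)) (Δ (- fromℕ (suc k)) f))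
      (Π-congʳ (- fromℕ k) (suc (2 ℕ.* k)) (Δ-cong
        (trans (+-congˡ (fromℕ-1+2* k)) (solve 1 (λ k → :- k :+ (:1 :+ (k :+ k)) := :1 :+ k) refl (fromℕ k)))
        ≋-refl))))

  Δ-Δ-neg : ∀ a f → Δ a (Δ (- a) f) ≋ D (D f) -ˢ const (a ^ 2) ⊛ f
  Δ-Δ-neg a f = ≋-trans (Δ-Δ a (- a) f) (≋-trans
    (+ˢ-cong (+ˢ-congˡ (-ˢ-cong (⊛-congʳ (≋-trans (const-cong (-‿inverseʳ a)) const-0))))
             (⊛-congʳ (≋-trans (const-cong (solve 1 (λ a → a :* (:- a) := :- (a :* (a :* :1))) refl a))
                               (const-neg (a ^ 2)))))
    (solveˢ 4 (λ f″ f′ q f → f″ ⊟ 𝟘 ⊡ f′ ⊞ (⊟ q) ⊡ f ≔ f″ ⊟ q ⊡ f) ≋-refl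
      (D (D f)) (D f) (const (a ^ 2)) f))

  -- From k to k + 1 both sides gain the factor D² - (k+1)²: the left one through the recurrence of
  -- u, the right one through the new extreme roots ±(k+1). The product over |j| ≤ k contains D
  -- once, so `f` enters differentiated.
  central≈Π : ∀ k f → central (suc k) f ≈ Π (- fromℕ k) (suc (2 ℕ.* k)) (D f) 0
  central≈Π zero f = begin
    central 1 f
      ≈⟨ central-suc 0 f ⟩
    1# * (fromℕ 1 * D (D f) 0) + (0# - fromℕ 0 ^ 2 * 0#)
      ≈⟨ solve 3 (λ x z y → :1 :* ((:1 :+ :0) :* x) :+ (:0 :- z :* :0)
           := x :- (:- :0) :* y) refl (D (D f) 0) (fromℕ 0 ^ 2) (D f 0) ⟩
    D (D f) 0 - (- 0#) * D f 0
      ≈⟨ +-congˡ (-‿cong (⊛₀ (const (- 0#)) (D f))) ⟨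
    Π (- 0#) 1 (D f) 0 ∎
  central≈Π (suc k) f = begin
    central (suc (suc k)) f
      ≈⟨ central-suc (suc k) f ⟩
    u (suc k) 0 * evenDerivative 0 (D (D f)) + (central (suc k) (D (D f)) - q * central (suc k) f)
      ≈⟨ +-cong (*-congʳ (u-suc-0 k)) (+-cong (central≈Π k (D (D f))) (-‿cong (*-congˡ (central≈Π k f)))) ⟩
    0# * evenDerivative 0 (D (D f)) + (P (D (D (D f))) 0 - q * P (D f) 0)
      ≈⟨ trans (+-congʳ (zeroˡ _)) (+-identityˡ _) ⟩
    P (D (D (D f))) 0 - q * P (D f) 0
      ≈⟨ +-congˡ (-‿cong (at (≋-trans (Π-const-⊛ a n q (D f)) (const-⊛ q (P (D f)))) 0)) ⟨
    P (D (D (D f))) 0 - P (const q ⊛ D f) 0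
      ≈⟨ at (Π-- a n (D (D (D f))) (const q ⊛ D f)) 0 ⟨
    P (D (D (D f)) -ˢ const q ⊛ D f) 0
      ≈⟨ at (Π-congʳ a n (Δ-Δ-neg (fromℕ (suc k)) (D f))) 0 ⟨
    P (Δ (fromℕ (suc k)) (Δ (- fromℕ (suc k)) (D f))) 0
      ≈⟨ at (Π-symmetric k (D f)) 0 ⟨
    Π (- fromℕ (suc k)) (suc (2 ℕ.* suc k)) (D f) 0 ∎
    where
    q a : Carrier
    q = fromℕ (suc k) ^ 2
    a = - fromℕ k
    n : ℕ
    n = suc (2 ℕ.* k)
    P : Series → Series
    P = Π a n

-- The generating series of the Bernoulli numbers and Euler polynomials.

module CauchyFormulas {c ℓ₁ ℓ₂} (ℝ : RealField c ℓ₁ ℓ₂) where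

  open RealField ℝ
  open CauchyPolynomials ℝ
  open OrderedField ℝ
  open SeriesAlgebra ℝ
  open DifferentialOperators ℝ
  open CentralFactorials ℝ
  open CommutativeRing commutativeRing using (semiring)
  open SemiringSum semiring using (sum-cong-≋; *-distribˡ-sum)
  open SemiringExp semiring using (^-congˡ; ^-assocʳ)
  open SetoidReasoning setoid

  -- τ = (e^X − 1) / X = ∫₀¹ e^{tX} dt and ρ = (1 − e^{−X}) / X = ∫₀¹ e^{−tX} dt.
  τ ρ : Series
  τ = tail (exp 1# -ˢ const 1#)
  ρ = tail (const 1# -ˢ exp (- 1#))

  X⊛τ : X ⊛ τ ≋ exp 1# -ˢ const 1#
  X⊛τ = X⊛tail (exp 1# -ˢ const 1#) (trans (+-congʳ (exp₀ 1#)) (-‿inverseʳ 1#))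

  X⊛ρ : X ⊛ ρ ≋ const 1# -ˢ exp (- 1#)
  X⊛ρ = X⊛tail (const 1# -ˢ exp (- 1#)) (trans (+-congˡ (-‿cong (exp₀ (- 1#)))) (-‿inverseʳ 1#))

  exp-inverse : ∀ a → exp a ⊛ exp (- a) ≋ const 1#
  exp-inverse a = ≋-trans (exp-+ a (- a)) (≋-trans (exp-cong (-‿inverseʳ a)) exp-0)

  -- This is the substitution t ↦ 1 - t in the integral of e^{tX}, the link between the two kinds of
  -- Cauchy polynomials.
  exp⊛ρ : exp 1# ⊛ ρ ≋ τ
  exp⊛ρ = X-cancel (≋-trans
    (solveˢ 3 (λ x e r → x ⊡ (e ⊡ r) ≔ e ⊡ (x ⊡ r)) ≋-refl X (exp 1#) ρ)
    (≋-trans (⊛-congˡ X⊛ρ) (≋-trans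
      (solveˢ 2 (λ e f → e ⊡ (𝟙 ⊟ f) ≔ e ⊟ e ⊡ f) ≋-refl (exp 1#) (exp (- 1#)))
      (≋-trans (+ˢ-congˡ (-ˢ-cong (exp-inverse 1#))) (≋-sym X⊛τ)))))

  ρ≋exp⊛τ : ρ ≋ exp (- 1#) ⊛ τ
  ρ≋exp⊛τ = ≋-sym (≋-trans (⊛-congˡ (≋-sym exp⊛ρ)) (≋-trans
    (solveˢ 3 (λ e f r → f ⊡ (e ⊡ r) ≔ (e ⊡ f) ⊡ r) ≋-refl (exp 1#) (exp (- 1#)) ρ)
    (≋-trans (⊛-congʳ (exp-inverse 1#)) (⊛-identityˡ ρ))))

  bernoulliSeries : Series
  bernoulliSeries = divide (tail X) (tail (exp 1# -ˢ const 1#)) [exp-1]/X#0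

  eulerSeries : Carrier → Series
  eulerSeries x = divide (const (fromℕ 2) *ˢ exp x) (exp 1# +ˢ const 1#) [exp+1]#0

  bernoulliSeries⊛τ : bernoulliSeries ⊛ τ ≋ const 1#
  bernoulliSeries⊛τ = ≋-trans (divide-⊛ (tail X) τ [exp-1]/X#0) tail-X

  bernoulliSeries⊛ρ : bernoulliSeries ⊛ ρ ≋ exp (- 1#)
  bernoulliSeries⊛ρ = ≋-trans (⊛-congˡ ρ≋exp⊛τ) (≋-trans
    (solveˢ 3 (λ b e t → b ⊡ (e ⊡ t) ≔ e ⊡ (b ⊡ t)) ≋-refl bernoulliSeries (exp (- 1#)) τ)
    (≋-trans (⊛-congˡ bernoulliSeries⊛τ) (⊛-identityʳ (exp (- 1#)))))

  bernoulliSeries₀ : bernoulliSeries 0 ≈ 1#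
  bernoulliSeries₀ = begin
    bernoulliSeries 0        ≈⟨ *-identityʳ _ ⟨
    bernoulliSeries 0 * 1#   ≈⟨ *-congˡ (trans (x-0≈x _) (trans (/ℕ-1 _) (*-identityʳ 1#))) ⟨
    bernoulliSeries 0 * τ 0  ≈⟨ ⊛₀ bernoulliSeries τ ⟨
    (bernoulliSeries ⊛ τ) 0  ≈⟨ at bernoulliSeries⊛τ 0 ⟩
    1#                       ∎

  eulerSeries⊛ : ∀ x → eulerSeries x ⊛ (exp 1# +ˢ const 1#) ≋ const (fromℕ 2) ⊛ exp x
  eulerSeries⊛ x = ≋-trans (divide-⊛ (const (fromℕ 2) *ˢ exp x) (exp 1# +ˢ const 1#) [exp+1]#0)
    (≋-sym (⊛≋*ˢ (const (fromℕ 2)) (exp x)))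

  -1^2* : ∀ i → (- 1#) ^ (2 ℕ.* i) ≈ 1# ^ (2 ℕ.* i)
  -1^2* i = trans (sym (^-assocʳ (- 1#) 2 i)) (trans
    (^-congˡ i (solve 0 ((:- :1) :* ((:- :1) :* :1) := :1 :* (:1 :* :1)) refl)) (^-assocʳ 1# 2 i))

  -- A formal antiderivative in X, unrelated to the integration over t. It presents a series as a
  -- derivative, the form in which `central≈Π` applies.
  integrate : Series → Series
  integrate f zero    = 0#
  integrate f (suc n) = f n /ℕ suc n

  D-integrate : ∀ f → D (integrate f) ≋ f
  D-integrate f = pointwise λ n → *-/ℕ (suc n) (f n)

  Π-exp-⊛₀ : ∀ a n z f → Π a n (exp z ⊛ f) 0 ≈ Π (a - z) n f 0
  Π-exp-⊛₀ a n z f = trans (at (Π-exp-⊛ a n z f) 0) (exp-⊛₀ z (Π (a - z) n f))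

  -- The even operator and its shift share the roots -k, ..., k. This lemma and `Π-even⁺` isolate
  -- the one further root of each, -k - 1 and k + 1, so that the two operators can be subtracted.
  Π-even : ∀ k f → Π (- fromℕ (suc k)) (2 ℕ.* suc k) f
    ≋ Π (- fromℕ k) (suc (2 ℕ.* k)) (Δ (- fromℕ (suc k)) f)
  Π-even k f = ≋-trans
    (pointwise λ i → reflexive (≡.cong (λ n → Π (- fromℕ (suc k)) n f i) (2*suc k)))
    (Π-cong (suc (2 ℕ.* k)) (solve 1 (λ k → :- (:1 :+ k) :+ :1 := :- k) refl (fromℕ k)) ≋-refl)

  Π-even⁺ : ∀ k f → Π (- fromℕ k) (2 ℕ.* suc k) f
    ≋ Π (- fromℕ k) (suc (2 ℕ.* k)) (Δ (fromℕ (suc k)) f)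
  Π-even⁺ k f = ≋-trans
    (pointwise λ i → reflexive (≡.cong (λ n → Π (- fromℕ k) n f i) (2*suc k)))
    (≋-trans (Π-last (- fromℕ k) (suc (2 ℕ.* k)) f) (Π-congʳ (- fromℕ k) (suc (2 ℕ.* k)) (Δ-cong
      (trans (+-congˡ (fromℕ-1+2* k)) (solve 1 (λ k → :- k :+ (:1 :+ (k :+ k)) := :1 :+ k) refl (fromℕ k)))
      ≋-refl)))

  -- Evaluation of the operators of even and odd order at X = 0.

  evenCauchy : ∀ k y → Π (- fromℕ (suc k)) (2 ℕ.* suc k) (exp y ⊛ ρ) 0
    ≈ (fromℕ (suc k) + fromℕ (suc k)) * central (suc k) (integrate (tail (exp y -ˢ bernoulliSeries)))
  evenCauchy k y = begin
    P (exp y ⊛ ρ) 0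
      ≈⟨ at (Π-congʳ a m split) 0 ⟩
    P (h -ˢ exp (- 1#) ⊛ h +ˢ exp (- 1#)) 0
      ≈⟨ at (≋-trans (Π-+ a m (h -ˢ exp (- 1#) ⊛ h) (exp (- 1#))) (+ˢ-congʳ (Π-- a m h (exp (- 1#) ⊛ h)))) 0 ⟩
    P h 0 - P (exp (- 1#) ⊛ h) 0 + P (exp (- 1#)) 0
      ≈⟨ +-cong (+-cong (at (Π-even k h) 0) (-‿cong shifted)) vanishing ⟩
    A (Δ (- n) h) 0 - A (Δ n h) 0 + 0#
      ≈⟨ +-identityʳ _ ⟩
    A (Δ (- n) h) 0 - A (Δ n h) 0
      ≈⟨ at (Π-- a′ m′ (Δ (- n) h) (Δ n h)) 0 ⟨
    A (Δ (- n) h -ˢ Δ n h) 0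
      ≈⟨ at (Π-congʳ a′ m′ difference) 0 ⟩
    A (const (n + n) ⊛ h) 0
      ≈⟨ at (≋-trans (Π-const-⊛ a′ m′ (n + n) h) (const-⊛ (n + n) (A h))) 0 ⟩
    (n + n) * A h 0
      ≈⟨ *-congˡ (at (Π-congʳ a′ m′ (D-integrate h)) 0) ⟨
    (n + n) * A (D (integrate h)) 0
      ≈⟨ *-congˡ (central≈Π k (integrate h)) ⟨
    (n + n) * central (suc k) (integrate h) ∎
    where
    n a a′ : Carrier
    n  = fromℕ (suc k)
    a  = - n
    a′ = - fromℕ k
    m m′ : ℕ
    m  = 2 ℕ.* suc k
    m′ = suc (2 ℕ.* k)
    P A : Series → Series
    P = Π a m
    A = Π a′ m′
    b h : Series
    b = bernoulliSeries
    h = tail (exp y -ˢ b)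

    X⊛h : X ⊛ h ≋ exp y -ˢ b
    X⊛h = X⊛tail (exp y -ˢ b) (trans (+-cong (exp₀ y) (-‿cong bernoulliSeries₀)) (-‿inverseʳ 1#))

    split : exp y ⊛ ρ ≋ h -ˢ exp (- 1#) ⊛ h +ˢ exp (- 1#)
    split = ≋-trans (solveˢ 3 (λ e b r → e ⊡ r ≔ (e ⊟ b) ⊡ r ⊞ b ⊡ r) ≋-refl (exp y) b ρ)
      (+ˢ-cong
        (≋-trans (⊛-congʳ (≋-sym X⊛h)) (≋-trans
          (solveˢ 3 (λ x h r → x ⊡ h ⊡ r ≔ x ⊡ r ⊡ h) ≋-refl X h ρ)
          (≋-trans (⊛-congʳ X⊛ρ)
            (solveˢ 2 (λ e h → (𝟙 ⊟ e) ⊡ h ≔ h ⊟ e ⊡ h) ≋-refl (exp (- 1#)) h))))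
        bernoulliSeries⊛ρ)

    shifted : P (exp (- 1#) ⊛ h) 0 ≈ A (Δ n h) 0
    shifted = trans (Π-exp-⊛₀ a m (- 1#) h) (trans
      (at (Π-cong m (solve 1 (λ k → :- (:1 :+ k) :- :- :1 := :- k) refl (fromℕ k)) ≋-refl) 0)
      (at (Π-even⁺ k h) 0))

    vanishing : P (exp (- 1#)) 0 ≈ 0#
    vanishing = begin
      P (exp (- 1#)) 0
        ≈⟨ at (Π-congʳ a m (≋-trans
             (exp-cong (solve 1 (λ k → :- :1 := :- (:1 :+ k) :+ k) refl (fromℕ k)))
             (≋-sym (exp-+ a (fromℕ k))))) 0 ⟩
      P (exp a ⊛ exp (fromℕ k)) 0
        ≈⟨ Π-exp-⊛₀ a m a (exp (fromℕ k)) ⟩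
      Π (a - a) m (exp (fromℕ k)) 0
        ≈⟨ at (Π-cong m (-‿inverseʳ a) ≋-refl) 0 ⟩
      Π 0# m (exp (fromℕ k)) 0
        ≈⟨ Π-exp₀ m (fromℕ k) ⟩
      fallingFactorial (fromℕ k) m
        ≈⟨ fallingFactorial-fromℕ k m (ℕ.m≤m+n (suc k) _) ⟩
      0# ∎

    difference : Δ (- n) h -ˢ Δ n h ≋ const (n + n) ⊛ h
    difference = ≋-trans (+ˢ-congʳ (+ˢ-congˡ (-ˢ-cong (⊛-congʳ (const-neg n)))))
      (≋-trans (solveˢ 3 (λ n h h′ → (h′ ⊟ (⊟ n) ⊡ h) ⊟ (h′ ⊟ n ⊡ h) ≔ (n ⊞ n) ⊡ h) ≋-refl (const n) h (D h))
        (⊛-congʳ (≋-sym (const-+ n n))))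

  -- The proof is carried out on twice the identity: `eulerSeries y` is twice the quotient of e^{yX}
  -- by e^X + 1, so doubling keeps halves out of the computation.
  oddCauchy : ∀ k y → Π (- fromℕ (suc k)) (suc (2 ℕ.* suc k)) (exp y ⊛ ρ) 0
    ≈ fromℕ (suc (2 ℕ.* suc k)) * central (suc k) (tail (eulerSeries y))
  oddCauchy k y = *-cancel-fromℕ 2 (begin
    fromℕ 2 * P (exp y ⊛ ρ) 0
      ≈⟨ at (≋-trans (Π-const-⊛ a m (fromℕ 2) (exp y ⊛ ρ)) (const-⊛ (fromℕ 2) (P (exp y ⊛ ρ)))) 0 ⟨
    P (const (fromℕ 2) ⊛ (exp y ⊛ ρ)) 0
      ≈⟨ at (Π-congʳ a m split) 0 ⟩
    P (const (e 0) ⊛ s +ˢ (exp 1# ⊛ h -ˢ exp (- 1#) ⊛ h)) 0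
      ≈⟨ at (≋-trans (Π-+ a m (const (e 0) ⊛ s) (exp 1# ⊛ h -ˢ exp (- 1#) ⊛ h))
           (+ˢ-cong (≋-trans (Π-const-⊛ a m (e 0) s) (const-⊛ (e 0) (P s)))
                    (Π-- a m (exp 1# ⊛ h) (exp (- 1#) ⊛ h)))) 0 ⟩
    e 0 * P s 0 + (P (exp 1# ⊛ h) 0 - P (exp (- 1#) ⊛ h) 0)
      ≈⟨ +-cong (trans (*-congˡ constantPart) (zeroʳ _)) (+-cong shifted⁻ (-‿cong shifted⁺)) ⟩
    0# + (A (Δ a (Δ (- N) h)) 0 - A (Δ n (Δ N h)) 0)
      ≈⟨ trans (+-identityˡ _) (sym (at (Π-- a′ m′ (Δ a (Δ (- N) h)) (Δ n (Δ N h))) 0)) ⟩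
    A (Δ a (Δ (- N) h) -ˢ Δ n (Δ N h)) 0
      ≈⟨ at (Π-congʳ a′ m′ difference) 0 ⟩
    A (const (fromℕ 2 * fromℕ m) ⊛ D h) 0
      ≈⟨ at (≋-trans (Π-const-⊛ a′ m′ (fromℕ 2 * fromℕ m) (D h)) (const-⊛ (fromℕ 2 * fromℕ m) (A (D h)))) 0 ⟩
    fromℕ 2 * fromℕ m * A (D h) 0
      ≈⟨ *-congˡ (central≈Π k h) ⟨
    fromℕ 2 * fromℕ m * central (suc k) h
      ≈⟨ *-assoc _ _ _ ⟩
    fromℕ 2 * (fromℕ m * central (suc k) h) ∎)
    where
    n N a a′ : Carrier
    n  = fromℕ (suc k)
    N  = n + 1#
    a  = - n
    a′ = - fromℕ k
    m m′ : ℕ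
    m  = suc (2 ℕ.* suc k)
    m′ = suc (2 ℕ.* k)
    P A : Series → Series
    P = Π a m
    A = Π a′ m′
    e h s : Series
    e = eulerSeries y
    h = tail e
    s = tail (exp 1# -ˢ exp (- 1#))

    X⊛s : X ⊛ s ≋ exp 1# -ˢ exp (- 1#)
    X⊛s = X⊛tail (exp 1# -ˢ exp (- 1#)) (trans (+-cong (exp₀ 1#) (-‿cong (exp₀ (- 1#)))) (-‿inverseʳ 1#))

    exp+1⊛ρ : (exp 1# +ˢ const 1#) ⊛ ρ ≋ s
    exp+1⊛ρ = X-cancel (≋-trans
      (solveˢ 3 (λ x e r → x ⊡ (e ⊡ r) ≔ e ⊡ (x ⊡ r)) ≋-refl X (exp 1# +ˢ const 1#) ρ)
      (≋-trans (⊛-congˡ X⊛ρ) (≋-trans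
        (solveˢ 2 (λ e f → (e ⊞ 𝟙) ⊡ (𝟙 ⊟ f) ≔ (e ⊟ f) ⊞ (𝟙 ⊟ e ⊡ f)) ≋-refl (exp 1#) (exp (- 1#)))
        (≋-trans (+ˢ-congˡ (+ˢ-congˡ (-ˢ-cong (exp-inverse 1#)))) (≋-trans
          (solveˢ 2 (λ e f → (e ⊟ f) ⊞ (𝟙 ⊟ 𝟙) ≔ e ⊟ f) ≋-refl (exp 1#) (exp (- 1#)))
          (≋-sym X⊛s))))))

    split : const (fromℕ 2) ⊛ (exp y ⊛ ρ) ≋ const (e 0) ⊛ s +ˢ (exp 1# ⊛ h -ˢ exp (- 1#) ⊛ h)
    split = ≋-trans (≋-sym (⊛-assoc (const (fromℕ 2)) (exp y) ρ))
      (≋-trans (⊛-congʳ (≋-sym (eulerSeries⊛ y)))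
      (≋-trans (⊛-assoc e (exp 1# +ˢ const 1#) ρ)
      (≋-trans (⊛-cong (head+X⊛tail e) exp+1⊛ρ)
      (≋-trans (solveˢ 4 (λ c x h s → (c ⊞ x ⊡ h) ⊡ s ≔ c ⊡ s ⊞ x ⊡ s ⊡ h) ≋-refl (const (e 0)) X h s)
      (+ˢ-congˡ (≋-trans (⊛-congʳ X⊛s)
        (solveˢ 3 (λ e f h → (e ⊟ f) ⊡ h ≔ e ⊡ h ⊟ f ⊡ h) ≋-refl (exp 1#) (exp (- 1#)) h)))))))

    s-odd : ∀ i → s (suc (2 ℕ.* i)) ≈ 0#
    s-odd i = trans
      (+-congˡ (-‿cong (*-congʳ (trans (reflexive (≡.cong ((- 1#) ^_) (≡.sym (2*suc i))))
        (trans (-1^2* (suc i)) (reflexive (≡.cong (1# ^_) (2*suc i))))))))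
      (-‿inverseʳ _)

    -- ∫s is odd, so all its even derivatives vanish at 0.
    constantPart : P s 0 ≈ 0#
    constantPart = begin
      P s 0                            ≈⟨ at (Π-congʳ a m (D-integrate s)) 0 ⟨
      P (D (integrate s)) 0            ≈⟨ central≈Π (suc k) (integrate s) ⟨
      central (suc (suc k)) (integrate s)
        ≈⟨ sum-cong-≋ {suc (suc k)} (λ i → summand (toℕ i)) ⟩
      sum {suc (suc k)} (λ i → 0# * u (suc (suc k)) (suc (toℕ i)))
        ≈⟨ *-distribˡ-sum {suc (suc k)} 0# (λ i → u (suc (suc k)) (suc (toℕ i))) ⟨
      0# * sum {suc (suc k)} (λ i → u (suc (suc k)) (suc (toℕ i)))
        ≈⟨ zeroˡ _ ⟩
      0#                               ∎
      where
      summand : ∀ i → u (suc (suc k)) (suc i) * evenDerivative (suc i) (integrate s)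
        ≈ 0# * u (suc (suc k)) (suc i)
      summand i = begin
        u (suc (suc k)) (suc i) * (x * integrate s (2 ℕ.* suc i))
          ≡⟨ ≡.cong (λ j → u (suc (suc k)) (suc i) * (x * integrate s j)) (2*suc i) ⟩
        u (suc (suc k)) (suc i) * (x * (s (suc (2 ℕ.* i)) * z))
          ≈⟨ *-congˡ (*-congˡ (*-congʳ (s-odd i))) ⟩
        u (suc (suc k)) (suc i) * (x * (0# * z))
          ≈⟨ solve 3 (λ u x z → u :* (x :* (:0 :* z)) := :0 :* u) refl _ _ _ ⟩
        0# * u (suc (suc k)) (suc i) ∎
        where
        x z : Carrier
        x = fromℕ ((2 ℕ.* suc i) !)
        z = inverse (fromℕ#0 (suc (suc (2 ℕ.* i))))

    -- The factor e^X lowers the roots -n, ..., n by one. Beside the core -k, ..., k this leaves -n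
    -- and -N; in `shifted⁺` the roots rise by one and the mirror pair n, N is left.
    shifted⁻ : P (exp 1# ⊛ h) 0 ≈ A (Δ a (Δ (- N) h)) 0
    shifted⁻ = begin
      P (exp 1# ⊛ h) 0          ≈⟨ Π-exp-⊛₀ a m 1# h ⟩
      Π (a - 1#) m h 0
        ≈⟨ at (Π-cong (2 ℕ.* suc k) (solve 1 (λ n → :- n :- :1 :+ :1 := :- n) refl n)
             (Δ-cong (solve 1 (λ n → :- n :- :1 := :- (n :+ :1)) refl n) ≋-refl)) 0 ⟩
      Π a (2 ℕ.* suc k) (Δ (- N) h) 0  ≈⟨ at (Π-even k (Δ (- N) h)) 0 ⟩
      A (Δ a (Δ (- N) h)) 0     ∎

    shifted⁺ : P (exp (- 1#) ⊛ h) 0 ≈ A (Δ n (Δ N h)) 0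
    shifted⁺ = begin
      P (exp (- 1#) ⊛ h) 0      ≈⟨ Π-exp-⊛₀ a m (- 1#) h ⟩
      Π (a - - 1#) m h 0
        ≈⟨ at (Π-cong m (solve 1 (λ k → :- (:1 :+ k) :- :- :1 := :- k) refl (fromℕ k)) ≋-refl) 0 ⟩
      Π a′ m h 0                ≈⟨ at (Π-last a′ (2 ℕ.* suc k) h) 0 ⟩
      Π a′ (2 ℕ.* suc k) (Δ (a′ + fromℕ (2 ℕ.* suc k)) h) 0
        ≈⟨ at (Π-congʳ a′ (2 ℕ.* suc k) (Δ-cong last≈N ≋-refl)) 0 ⟩
      Π a′ (2 ℕ.* suc k) (Δ N h) 0  ≈⟨ at (Π-even⁺ k (Δ N h)) 0 ⟩
      A (Δ n (Δ N h)) 0         ∎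
      where
      last≈N : a′ + fromℕ (2 ℕ.* suc k) ≈ N
      last≈N = trans (+-congˡ (trans (reflexive (≡.cong fromℕ (2*suc k))) (+-congˡ (fromℕ-1+2* k))))
        (solve 1 (λ k → :- k :+ (:1 :+ (:1 :+ (k :+ k))) := (:1 :+ k) :+ :1) refl (fromℕ k))

    -- The pairs -n, -N and n, N have the same product and opposite sums, so by `Δ-Δ` only 2 (n + N)
    -- D survives, where n + N = 2n + 1.
    difference : Δ a (Δ (- N) h) -ˢ Δ n (Δ N h) ≋ const (fromℕ 2 * fromℕ m) ⊛ D h
    difference = ≋-trans (+ˢ-cong (Δ-Δ a (- N) h) (-ˢ-cong (Δ-Δ n N h)))
      (≋-trans (+ˢ-congʳ (+ˢ-cong
          (+ˢ-congˡ (-ˢ-cong (⊛-congʳ (≋-trans (const-cong (solve 2 (λ x y → :- x :+ :- y := :- (x :+ y)) refl n N))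
                                               (const-neg (n + N))))))
          (⊛-congʳ (const-cong (solve 2 (λ x y → (:- x) :* (:- y) := x :* y) refl n N)))))
      (≋-trans (solveˢ 5 (λ p q h h′ h″ →
          (h″ ⊟ (⊟ p) ⊡ h′ ⊞ q ⊡ h) ⊟ (h″ ⊟ p ⊡ h′ ⊞ q ⊡ h) ≔ (p ⊞ p) ⊡ h′)
          ≋-refl (const (n + N)) (const (n * N)) h (D h) (D (D h)))
      (⊛-congʳ (≋-trans (≋-sym (const-+ (n + N) (n + N))) (const-cong
        (trans (solve 1 (λ n → (n :+ (n :+ :1)) :+ (n :+ (n :+ :1)) :=
                  (:1 :+ (:1 :+ :0)) :* (:1 :+ (n :+ n))) refl n)
               (*-congˡ (sym (fromℕ-1+2* (suc k))))))))))

  -- Integration over t, coefficient by coefficient.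

  ∫exp : ∀ k → Integral (λ t → exp t k) (τ k)
  ∫exp k = Integral-cong
    (λ t → scaled (t ^ k))
    (sym (trans (x-0≈x _) (trans (*-congʳ (1^ (suc k))) (*-comm _ _))))
    (Integral-* (!⁻¹ (suc k)) (Integral-^ k))
    where
    scaled : ∀ x → !⁻¹ (suc k) * (fromℕ (suc k) * x) ≈ x * !⁻¹ k
    scaled x = trans (solve 3 (λ i n x → i :* (n :* x) := x :* (n :* i)) refl _ _ _)
      (*-congˡ (suc*!⁻¹ k))

  neg-^ : ∀ x k → (- x) ^ k ≈ (- 1#) ^ k * x ^ k
  neg-^ x zero    = sym (*-identityˡ 1#)
  neg-^ x (suc k) = trans (*-congˡ (neg-^ x k))
    (solve 3 (λ x p q → (:- x) :* (p :* q) := (:- :1) :* p :* (x :* q)) refl _ _ _)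

  ∫exp-neg : ∀ k → Integral (λ t → exp (- t) k) (ρ k)
  ∫exp-neg k = Integral-cong
    (λ t → trans (sym (*-assoc _ _ _)) (*-congʳ (sym (neg-^ t k))))
    (solve 2 (λ s i → s :* (i :- :0) := :0 :- (:- :1) :* s :* i) refl ((- 1#) ^ k) (!⁻¹ (suc k)))
    (Integral-* ((- 1#) ^ k) (Integral-cong (λ t → refl)
      (+-congʳ (trans (*-congʳ (1^ (suc k))) (*-identityˡ _))) (∫exp k)))

  -- Every coefficient of a product with a fixed series, or of `Δ`, is a finite linear combination
  -- of coefficients. Linearity of the integral thus carries all operators in X past it, with no
  -- question of convergence.
  Integralˢ : (Carrier → Series) → Series → Set _
  Integralˢ f I = ∀ k → Integral (λ t → f t k) (I k)

  Integralˢ-⊛ : ∀ {f I} g → Integralˢ f I → Integralˢ (λ t → f t ⊛ g) (I ⊛ g)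
  Integralˢ-⊛ {f} {I} g ∫f k = Integral-cong
    (λ t → trans (sum-cong-≋ {suc k} (λ i → *-comm (g (k ℕ.∸ toℕ i)) (f t (toℕ i)))) (sym (at (⊛≋*ˢ (f t) g) k)))
    (trans (sum-cong-≋ {suc k} (λ i → *-comm (g (k ℕ.∸ toℕ i)) (I (toℕ i)))) (sym (at (⊛≋*ˢ I g) k)))
    (Integral-sum {suc k} (λ i → Integral-* (g (k ℕ.∸ toℕ i)) (∫f (toℕ i))))

  Integralˢ-Δ : ∀ {f I} a → Integralˢ f I → Integralˢ (λ t → Δ a (f t)) (Δ a I)
  Integralˢ-Δ {f} {I} a ∫f k = Integral-cong
    (λ t → sym (expand (f t))) (sym (expand I))
    (Integral-+ (Integral-* (fromℕ (suc k)) (∫f (suc k))) (Integral-* (- a) (∫f k)))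
    where
    expand : ∀ g → Δ a g k ≈ fromℕ (suc k) * g (suc k) + (- a) * g k
    expand g = +-congˡ (trans (-‿cong (at (const-⊛ a g) k))
      (solve 2 (λ a x → :- (a :* x) := (:- a) :* x) refl a (g k)))

  Integralˢ-Π : ∀ {f I} a n → Integralˢ f I → Integralˢ (λ t → Π a n (f t)) (Π a n I)
  Integralˢ-Π a zero    ∫f = ∫f
  Integralˢ-Π a (suc n) ∫f = Integralˢ-Π (a + 1#) n (Integralˢ-Δ a ∫f)

  binomial≈Π : ∀ n {z} f → exp z ≋ f → Π 0# n f 0 * !⁻¹ n ≈ binomial z n
  binomial≈Π n {z} f exp≋f = *-congʳ (trans (at (Π-congʳ 0# n (≋-sym exp≋f)) 0) (Π-exp₀ n z))

  !*[!⁻¹*] : ∀ n z → fromℕ (n !) * (!⁻¹ n * z) ≈ z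
  !*[!⁻¹*] n z = trans (sym (*-assoc _ _ _)) (trans (*-congʳ (!*!⁻¹ n)) (*-identityˡ z))

  ĉ-Π : ∀ n x {y} → y ≈ Π 0# n (exp x ⊛ ρ) 0 → ĉ[ n , x ]≈ y
  ĉ-Π n x y≈ = _ ,
    isIntegral (Integral-cong
      (λ t → trans (*-comm _ _) (binomial≈Π n (exp (- t) ⊛ exp x)
        (≋-sym (≋-trans (exp-+ (- t) x) (exp-cong (+-comm _ _))))))
      refl
      (Integral-* (!⁻¹ n) (Integralˢ-Π 0# n (Integralˢ-⊛ (exp x) ∫exp-neg) 0))) ,
    trans y≈ (trans (at (Π-congʳ 0# n (⊛-comm (exp x) ρ)) 0) (sym (!*[!⁻¹*] n _)))

  c-Π : ∀ n x {y} → y ≈ Π 0# n (exp (1# - x) ⊛ ρ) 0 → c[ n , x ]≈ y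
  c-Π n x y≈ = _ ,
    isIntegral (Integral-cong
      (λ t → trans (*-comm _ _) (binomial≈Π n (exp t ⊛ exp (- x)) (≋-sym (exp-+ t (- x)))))
      refl
      (Integral-* (!⁻¹ n) (Integralˢ-Π 0# n (Integralˢ-⊛ (exp (- x)) ∫exp) 0))) ,
    trans y≈ (trans (at (Π-congʳ 0# n exp⊛ρ≋) 0) (sym (!*[!⁻¹*] n _)))
    where
    exp⊛ρ≋ : exp (1# - x) ⊛ ρ ≋ τ ⊛ exp (- x)
    exp⊛ρ≋ = ≋-trans (⊛-congʳ (≋-sym (exp-+ 1# (- x)))) (≋-trans
      (solveˢ 3 (λ e f r → e ⊡ f ⊡ r ≔ e ⊡ r ⊡ f) ≋-refl (exp 1#) (exp (- x)) ρ)
      (⊛-congʳ exp⊛ρ))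

  Π-centred : ∀ n m x f → Π 0# m (exp x ⊛ f) 0 ≈ Π (- fromℕ n) m (exp (x - fromℕ n) ⊛ f) 0
  Π-centred n m x f = begin
    Π 0# m (exp x ⊛ f) 0
      ≈⟨ at (Π-congʳ 0# m (≋-trans
           (⊛-congʳ (≋-trans (exp-cong (solve 2 (λ n x → x := n :+ (x :- n)) refl N x)) (≋-sym (exp-+ N (x - N)))))
           (⊛-assoc (exp N) (exp (x - N)) f))) 0 ⟩
    Π 0# m (exp N ⊛ (exp (x - N) ⊛ f)) 0
      ≈⟨ Π-exp-⊛₀ 0# m N (exp (x - N) ⊛ f) ⟩
    Π (0# - N) m (exp (x - N) ⊛ f) 0
      ≈⟨ at (Π-cong m (+-identityˡ (- N)) ≋-refl) 0 ⟩
    Π (- N) m (exp (x - N) ⊛ f) 0 ∎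
    where
    N : Carrier
    N = fromℕ n

  -- The sums of the theorem as values of `central`.

  bernoulliSum : ℕ → Carrier → Carrier
  bernoulliSum n y = fromℕ n * Σ[1≤m≤ n ] (λ m → (u n m /ℕ m) * (y ^ (2 ℕ.* m) - B (2 ℕ.* m)))

  -- The derivative of order 2m of the antiderivative at 0 is (y^{2m} - B_{2m}) / (2m). The factor 2
  -- in `fromℕ n + fromℕ n` turns 1/(2m) into 1/m.
  bernoulliSum≈central : ∀ n y → bernoulliSum n y
    ≈ (fromℕ n + fromℕ n) * central n (integrate (tail (exp y -ˢ bernoulliSeries)))
  bernoulliSum≈central n y = begin
    bernoulliSum n y
      ≈⟨ *-congˡ (trans (sum-cong-≋ {n} (λ i → summand (toℕ i))) (sym (*-distribˡ-sum {n} (fromℕ 2) _))) ⟩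
    fromℕ n * (fromℕ 2 * central n g)
      ≈⟨ solve 2 (λ n x → n :* ((:1 :+ (:1 :+ :0)) :* x) := (n :+ n) :* x) refl _ _ ⟩
    (fromℕ n + fromℕ n) * central n g ∎
    where
    g : Series
    g = integrate (tail (exp y -ˢ bernoulliSeries))

    summand : ∀ i → (u n (suc i) /ℕ suc i) * (y ^ (2 ℕ.* suc i) - B (2 ℕ.* suc i))
      ≈ fromℕ 2 * (u n (suc i) * evenDerivative (suc i) g)
    summand i = begin
      v * inverse (fromℕ#0 m) * (y ^ 2m - k! * b)
        ≈⟨ *-cong (*-congˡ inverse≈) (+-congʳ (sym (trans (*-congˡ (*-comm _ _)) (!*[!⁻¹*] 2m _)))) ⟩
      v * (fromℕ 2 * inverse (fromℕ#0 2m)) * (k! * (y ^ 2m * !⁻¹ 2m) - k! * b)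
        ≈⟨ solve 6 (λ v t i k e b → v :* (t :* i) :* (k :* e :- k :* b)
             := t :* (v :* (k :* ((e :- b) :* i)))) refl _ _ _ _ _ _ ⟩
      fromℕ 2 * (v * (k! * ((y ^ 2m * !⁻¹ 2m - b) * inverse (fromℕ#0 2m)))) ∎
      where
      m 2m : ℕ
      m  = suc i
      2m = 2 ℕ.* m
      v k! b : Carrier
      v  = u n m
      k! = fromℕ (2m !)
      b  = bernoulliSeries 2m
      inverse≈ : inverse (fromℕ#0 m) ≈ fromℕ 2 * inverse (fromℕ#0 2m)
      inverse≈ = *-cancel-fromℕ m (begin
        fromℕ m * inverse (fromℕ#0 m)           ≈⟨ trans (*-comm _ _) (inverse-* (fromℕ#0 m)) ⟩
        1#                                      ≈⟨ trans (*-comm _ _) (inverse-* (fromℕ#0 2m)) ⟨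
        fromℕ 2m * inverse (fromℕ#0 2m)         ≈⟨ *-congʳ (fromℕ-* 2 m) ⟩
        fromℕ 2 * fromℕ m * inverse (fromℕ#0 2m)
          ≈⟨ solve 3 (λ t m i → t :* m :* i := m :* (t :* i)) refl _ _ _ ⟩
        fromℕ m * (fromℕ 2 * inverse (fromℕ#0 2m)) ∎)

  eulerSum : ℕ → Carrier → Carrier
  eulerSum n y = Σ[1≤m≤ n ] (λ m → (u n m /ℕ suc (2 ℕ.* m)) * E (suc (2 ℕ.* m)) y)

  -- Passing to `tail` lowers the index by one while the coefficient stays that of E_{2m+1}; the
  -- quotient of (2m)! by (2m+1)! is the denominator 2m + 1.
  eulerSum≈central : ∀ n y → eulerSum n y ≈ central n (tail (eulerSeries y))
  eulerSum≈central n y = sum-cong-≋ {n} (λ i → summand (suc (toℕ i)))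
    where
    summand : ∀ m → (u n m /ℕ suc (2 ℕ.* m)) * E (suc (2 ℕ.* m)) y
      ≈ u n m * evenDerivative m (tail (eulerSeries y))
    summand m = begin
      v * j * (fromℕ (suc k !) * e)              ≈⟨ *-congˡ (*-congʳ (fromℕ-* (suc k) (k !))) ⟩
      v * j * (fromℕ (suc k) * fromℕ (k !) * e)
        ≈⟨ solve 5 (λ v j n f e → v :* j :* (n :* f :* e) := v :* (j :* n :* (f :* e))) refl _ _ _ _ _ ⟩
      v * (j * fromℕ (suc k) * (fromℕ (k !) * e))
        ≈⟨ *-congˡ (trans (*-congʳ (inverse-* (fromℕ#0 (suc k)))) (*-identityˡ _)) ⟩
      v * (fromℕ (k !) * e)                      ∎
      where
      k : ℕ
      k = 2 ℕ.* m
      v j e : Carrier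
      v = u n m
      j = inverse (fromℕ#0 (suc k))
      e = eulerSeries y (suc k)

  -- Reflection of the Euler polynomials.

  -- The substitution X ↦ -X.
  σ : Series → Series
  σ f k = (- 1#) ^ k * f k

  σ-cong : ∀ {f g} → f ≋ g → σ f ≋ σ g
  σ-cong f≋g = pointwise λ k → *-congˡ (at f≋g k)

  σ-exp : ∀ a → σ (exp a) ≋ exp (- a)
  σ-exp a = pointwise λ k → trans (sym (*-assoc _ _ _)) (*-congʳ (sym (neg-^ a k)))

  σ-const : ∀ a → σ (const a) ≋ const a
  σ-const a = pointwise λ where
    zero    → *-identityˡ a
    (suc k) → zeroʳ _

  σ-+ˢ : ∀ f g → σ (f +ˢ g) ≋ σ f +ˢ σ g
  σ-+ˢ f g = pointwise λ k → distribˡ _ _ _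

  σ-⊛ : ∀ f g → σ (f ⊛ g) ≋ σ f ⊛ σ g
  σ-⊛ f g = ≋-trans (σ-cong (⊛≋*ˢ f g)) (≋-trans (pointwise (go f)) (≋-sym (⊛≋*ˢ (σ f) (σ g))))
    where
    go : ∀ f k → σ (f *ˢ g) k ≈ (σ f *ˢ σ g) k
    go f zero = solve 2 (λ f g → :1 :* (f :* g :+ :0) := :1 :* f :* (:1 :* g) :+ :0) refl _ _
    go f (suc k) = begin
      - 1# * s * (f 0 * g (suc k) + (tail f *ˢ g) k)
        ≈⟨ solve 4 (λ s f g p → (:- :1) :* s :* (f :* g :+ p)
             := :1 :* f :* ((:- :1) :* s :* g) :+ (:- :1) :* (s :* p)) refl _ _ _ _ ⟩
      1# * f 0 * (- 1# * s * g (suc k)) + - 1# * σ (tail f *ˢ g) k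
        ≈⟨ +-congˡ (*-congˡ (go (tail f) k)) ⟩
      1# * f 0 * (- 1# * s * g (suc k)) + - 1# * (σ (tail f) *ˢ σ g) k
        ≈⟨ +-congˡ (at (scale-*ˢ (- 1#) (σ (tail f)) (σ g)) k) ⟨
      1# * f 0 * (- 1# * s * g (suc k)) + (scale (- 1#) (σ (tail f)) *ˢ σ g) k
        ≈⟨ +-congˡ (at (*ˢ-cong {scale (- 1#) (σ (tail f))} {tail (σ f)}
             (pointwise λ j → sym (*-assoc (- 1#) ((- 1#) ^ j) (f (suc j)))) (≋-refl {σ g})) k) ⟩
      (σ f *ˢ σ g) (suc k) ∎
      where
      s : Carrier
      s = (- 1#) ^ k

  -- Both sides multiplied by e^X + 1 = e^X (e^{−X} + 1) give 2 e^{(1−z)X}.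
  eulerSeries-reflect : ∀ z → eulerSeries (1# - z) ≋ σ (eulerSeries z)
  eulerSeries-reflect z = ⊛-cancelʳ (exp 1# +ˢ const 1#) [exp+1]#0
    (≋-trans (eulerSeries⊛ (1# - z)) (≋-sym σe⊛))
    where
    e : Series
    e = eulerSeries z
    1+exp : const 1# +ˢ exp 1# ≋ exp 1# ⊛ σ (exp 1# +ˢ const 1#)
    1+exp = ≋-sym (≋-trans
      (⊛-congˡ (≋-trans (σ-+ˢ (exp 1#) (const 1#)) (+ˢ-cong (σ-exp 1#) (σ-const 1#))))
      (≋-trans (solveˢ 2 (λ e f → e ⊡ (f ⊞ 𝟙) ≔ e ⊡ f ⊞ e) ≋-refl (exp 1#) (exp (- 1#)))
        (+ˢ-congʳ (exp-inverse 1#))))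

    σe⊛ : σ e ⊛ (exp 1# +ˢ const 1#) ≋ const (fromℕ 2) ⊛ exp (1# - z)
    σe⊛ =
      ≋-trans (⊛-congˡ (≋-trans (solveˢ 1 (λ e → e ⊞ 𝟙 ≔ 𝟙 ⊞ e) ≋-refl (exp 1#)) 1+exp))
      (≋-trans (solveˢ 3 (λ e f g → e ⊡ (f ⊡ g) ≔ f ⊡ (e ⊡ g)) ≋-refl (σ e) (exp 1#) (σ (exp 1# +ˢ const 1#)))
      (≋-trans (⊛-congˡ (≋-trans (≋-sym (σ-⊛ e (exp 1# +ˢ const 1#)))
        (≋-trans (σ-cong (eulerSeries⊛ z))
        (≋-trans (σ-⊛ (const (fromℕ 2)) (exp z)) (⊛-cong (σ-const (fromℕ 2)) (σ-exp z))))))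
      (≋-trans (solveˢ 3 (λ c f g → f ⊡ (c ⊡ g) ≔ c ⊡ (f ⊡ g)) ≋-refl (const (fromℕ 2)) (exp 1#) (exp (- z)))
        (⊛-congˡ (exp-+ 1# (- z))))))

  -- Only odd indices occur, so the sign (-1)^{2m+1} is the same for all summands. It is the source
  -- of the minus sign in the formula for c_{2n+1}.
  eulerSum-reflect : ∀ n z → eulerSum n (1# - z) ≈ - eulerSum n z
  eulerSum-reflect n z = begin
    eulerSum n (1# - z)
      ≈⟨ sum-cong-≋ {n} (λ i → summand (suc (toℕ i))) ⟩
    sum {n} (λ i → - 1# * f (suc (toℕ i)))
      ≈⟨ *-distribˡ-sum {n} (- 1#) (λ i → f (suc (toℕ i))) ⟨
    - 1# * eulerSum n z
      ≈⟨ solve 1 (λ x → (:- :1) :* x := :- x) refl _ ⟩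
    - eulerSum n z ∎
    where
    f : ℕ → Carrier
    f m = (u n m /ℕ suc (2 ℕ.* m)) * E (suc (2 ℕ.* m)) z

    summand : ∀ m → (u n m /ℕ suc (2 ℕ.* m)) * E (suc (2 ℕ.* m)) (1# - z) ≈ - 1# * f m
    summand m = begin
      v * (k! * eulerSeries (1# - z) (suc (2 ℕ.* m)))
        ≈⟨ *-congˡ (*-congˡ (at (eulerSeries-reflect z) (suc (2 ℕ.* m)))) ⟩
      v * (k! * (- 1# * (- 1#) ^ (2 ℕ.* m) * e))
        ≈⟨ *-congˡ (*-congˡ (*-congʳ (*-congˡ (trans (-1^2* m) (1^ (2 ℕ.* m)))))) ⟩
      v * (k! * (- 1# * 1# * e))
        ≈⟨ solve 3 (λ v k e → v :* (k :* ((:- :1) :* :1 :* e)) := (:- :1) :* (v :* (k :* e))) refl _ _ _ ⟩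
      - 1# * (v * (k! * e)) ∎
      where
      v k! e : Carrier
      v  = u n m /ℕ suc (2 ℕ.* m)
      k! = fromℕ (suc (2 ℕ.* m) !)
      e  = eulerSeries z (suc (2 ℕ.* m))

  -- The four formulas.

  bernoulliSum≈Π : ∀ k x → bernoulliSum (suc k) (x - fromℕ (suc k)) ≈ Π 0# (2 ℕ.* suc k) (exp x ⊛ ρ) 0
  bernoulliSum≈Π k x = trans (bernoulliSum≈central (suc k) (x - fromℕ (suc k)))
    (sym (trans (Π-centred (suc k) (2 ℕ.* suc k) x ρ) (evenCauchy k (x - fromℕ (suc k)))))

  eulerSum≈Π : ∀ k x → fromℕ (suc (2 ℕ.* suc k)) * eulerSum (suc k) (x - fromℕ (suc k))
    ≈ Π 0# (suc (2 ℕ.* suc k)) (exp x ⊛ ρ) 0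
  eulerSum≈Π k x = trans (*-congˡ (eulerSum≈central (suc k) (x - fromℕ (suc k))))
    (sym (trans (Π-centred (suc k) (suc (2 ℕ.* suc k)) x ρ) (oddCauchy k (x - fromℕ (suc k)))))

  -- Only even powers of y occur. At 1 - x the centred argument is 1 - x - n, and this evenness
  -- changes it to x + n - 1.
  bernoulliSum-neg : ∀ n {y z} → y ≈ - z → bernoulliSum n y ≈ bernoulliSum n z
  bernoulliSum-neg n {y} {z} y≈-z = *-congˡ (sum-cong-≋ {n} (λ i → *-congˡ (+-congʳ (even-^ (suc (toℕ i))))))
    where
    even-^ : ∀ m → y ^ (2 ℕ.* m) ≈ z ^ (2 ℕ.* m)
    even-^ m = trans (^-congˡ (2 ℕ.* m) y≈-z) (trans (neg-^ z (2 ℕ.* m))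
      (trans (*-congʳ (trans (-1^2* m) (1^ (2 ℕ.* m)))) (*-identityˡ _)))

  -- Invariance under `_≈_` is not traced through long division: the quotient is determined by its
  -- product with e^X + 1, whose constant term is invertible.
  eulerSum-cong : ∀ n {y z} → y ≈ z → eulerSum n y ≈ eulerSum n z
  eulerSum-cong n {y} {z} y≈z = begin
    eulerSum n y                       ≈⟨ eulerSum≈central n y ⟩
    central n (tail (eulerSeries y))   ≈⟨ sum-cong-≋ {n} (λ i →
                                            *-congˡ (*-congˡ (at euler-cong (suc (2 ℕ.* suc (toℕ i)))))) ⟩
    central n (tail (eulerSeries z))   ≈⟨ eulerSum≈central n z ⟨
    eulerSum n z                       ∎
    where
    euler-cong : eulerSeries y ≋ eulerSeries z
    euler-cong = ⊛-cancelʳ (exp 1# +ˢ const 1#) [exp+1]#0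
      (≋-trans (eulerSeries⊛ y) (≋-trans (⊛-congˡ (exp-cong y≈z)) (≋-sym (eulerSeries⊛ z))))

  ĉ-even : ∀ k x → ĉ[ 2 ℕ.* suc k , x ]≈ bernoulliSum (suc k) (x - fromℕ (suc k))
  ĉ-even k x = ĉ-Π (2 ℕ.* suc k) x (bernoulliSum≈Π k x)

  c-even : ∀ k x → c[ 2 ℕ.* suc k , x ]≈ bernoulliSum (suc k) (x + fromℕ (suc k) - 1#)
  c-even k x = c-Π (2 ℕ.* suc k) x (trans
    (sym (bernoulliSum-neg (suc k) (solve 2 (λ n x → :1 :- x :- n := :- (x :+ n :- :1)) refl (fromℕ (suc k)) x)))
    (bernoulliSum≈Π k (1# - x)))

  ĉ-odd : ∀ k x → ĉ[ suc (2 ℕ.* suc k) , x ]≈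
    fromℕ (suc (2 ℕ.* suc k)) * eulerSum (suc k) (x - fromℕ (suc k))
  ĉ-odd k x = ĉ-Π (suc (2 ℕ.* suc k)) x (eulerSum≈Π k x)

  c-odd : ∀ k x → c[ suc (2 ℕ.* suc k) , x ]≈
    - fromℕ (suc (2 ℕ.* suc k)) * eulerSum (suc k) (x + fromℕ (suc k))
  c-odd k x = c-Π (suc (2 ℕ.* suc k)) x (begin
    - N * eulerSum (suc k) (x + n)       ≈⟨ solve 2 (λ n x → (:- n) :* x := n :* (:- x)) refl _ _ ⟩
    N * - eulerSum (suc k) (x + n)       ≈⟨ *-congˡ (eulerSum-reflect (suc k) (x + n)) ⟨
    N * eulerSum (suc k) (1# - (x + n))
      ≈⟨ *-congˡ (eulerSum-cong (suc k) (solve 2 (λ n x → :1 :- (x :+ n) := :1 :- x :- n) refl n x)) ⟩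
    N * eulerSum (suc k) (1# - x - n)    ≈⟨ eulerSum≈Π k (1# - x) ⟩
    Π 0# (suc (2 ℕ.* suc k)) (exp (1# - x) ⊛ ρ) 0 ∎)
    where
    n N : Carrier
    n = fromℕ (suc k)
    N = fromℕ (suc (2 ℕ.* suc k))

theorem4 : ∀ {c ℓ₁ ℓ₂} (ℝ : RealField c ℓ₁ ℓ₂) →
    let open RealField ℝ
        open CauchyPolynomials ℝ in
    (n : ℕ) .{{_ : NonZero n}} (x : Carrier) →
      (c[ 2 ℕ.* n , x ]≈
        fromℕ n * Σ[1≤m≤ n ] (λ m →
          (u n m /ℕ m) * ((x + fromℕ n - 1#) ^ (2 ℕ.* m) - B (2 ℕ.* m))))
      × (ĉ[ 2 ℕ.* n , x ]≈
        fromℕ n * Σ[1≤m≤ n ] (λ m →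
          (u n m /ℕ m) * ((x - fromℕ n) ^ (2 ℕ.* m) - B (2 ℕ.* m))))
      × (c[ suc (2 ℕ.* n) , x ]≈
        - fromℕ (suc (2 ℕ.* n)) * Σ[1≤m≤ n ] (λ m →
          (u n m /ℕ suc (2 ℕ.* m)) * E (suc (2 ℕ.* m)) (x + fromℕ n)))
      × (ĉ[ suc (2 ℕ.* n) , x ]≈
        fromℕ (suc (2 ℕ.* n)) * Σ[1≤m≤ n ] (λ m →
          (u n m /ℕ suc (2 ℕ.* m)) * E (suc (2 ℕ.* m)) (x - fromℕ n)))
theorem4 ℝ (suc k) x = c-even k x , ĉ-even k x , c-odd k x , ĉ-odd k x
  where open CauchyFormulas ℝ
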